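{- Let $(X,S)$ be a coherent configuration. For $a,b,c\in S$ put $$\dot\nabla_{ab}^c=\sqrt{\frac{\|c\|}{\|a\|\,\|b\|}}\;\nabla_{ab}^c,$$ so that $\dot\nabla\colon S\otimes S\to S$ is a morphism in $\mathbf{Mat}_{\mathbb R_0^+}$, and let $e\colon I\to S$ be given by $e_*^a=1$ if $a\subseteq\mathrm{id}_X$ and $0$ otherwise. Then $(S,\dot\nabla,e)$ is a dagger Frobenius structure in $\mathbf{Mat}_{\mathbb R_0^+}$.
   Context: $\mathbf{Mat}_{\mathbb R_0^+}$ is the category whose objects are finite sets and whose morphisms $f\colon X\to Y$ are matrices $(f_x^y)_{x\in X,y\in Y}$ of non-negative reals, with composition $(g\circ f)_a^c=\sum_{b}f_a^b g_b^c$. It is symmetric monoidal with $X\otimes Y=X\times Y$, $(f\otimes g)_{ac}^{bd}=f_a^b g_c^d$, unit object $I=\{*\}$, and structural isomorphisms transferred from finite sets; $f^\dagger$ is the transpose of $f$. A coherent configuration $(X,S)$ is a finite set $X$ with a partition $S$ of $X\times X$ such that: if $p\in S$ contains some $(x,x)$ then $p\subseteq\mathrm{id}_X$; for $a,b,c\in S$ the number $\nabla_{ab}^c$ of $z\in X$ with $(x,z)\in a$, $(z,y)\in b$ is the same for all $(x,y)\in c$; and $c\in S$ implies $c^{ -1}=\{(y,x):(x,y)\in c\}\in S$. The valency $\|a\|$ of $a\in S$ is the number of $y\in X$ with $(x,y)\in a$, for any $x$ for which at least one such $y$ exists (it is independent of $x$). A dagger Frobenius structure in $\mathbf{Mat}_{\mathbb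 R_0^+}$ is a triple $(S,\mu,e)$ with $\mu\colon S\otimes S\to S$, $e\colon I\to S$ such that $(S,\mu,e)$ is a monoid (so that $(S,\mu^\dagger,e^\dagger)$ is a comonoid) and the Frobenius law holds: $(\mu\otimes\mathrm{id}_S)\circ(\mathrm{id}_S\otimes\mu^\dagger)=\mu^\dagger\circ\mu=(\mathrm{id}_S\otimes\mu)\circ(\mu^\dagger\otimes\mathrm{id}_S)$. -}

module Defs where

open import Algebra.Bundles.Raw using (RawSemiring)
import Algebra.Definitions.RawMonoid as RawMonoidDefs
open import Data.Bool.Base using (if_then_else_)
open import Data.Fin.Base using (Fin; zero; suc)
import Data.Fin.Properties as Fin
open import Data.Integer.Base as ℤ using (+_; +<+)
import Data.Integer.Properties as ℤ
open import Data.Nat.Base as ℕ using (ℕ; zero; suc; s≤s; z≤n)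
import Data.Nat.DivMod as ℕ
import Data.Nat.Properties as ℕ
open import Data.Product using (∃-syntax; ∃!; _×_; _,_; proj₁; proj₂; assocˡ; assocʳ)
open import Data.Product.Function.NonDependent.Propositional using (_×-↔_)
open import Data.Rational.Base as ℚ
  using (ℚ; 0ℚ; 1ℚ; _/_; _<_; _≤_; _+_; _*_; _-_; -_; ∣_∣; ↥_; ↧ₙ_; Positive; NonNegative)
import Data.Rational.Properties as ℚ
import Data.Integer.Solver as ℤSolver
open import Data.Rational.Solver using (module +-*-Solver)
import Data.Rational.Unnormalised.Base as ℚᵘ
import Data.Rational.Unnormalised.Properties as ℚᵘ
open import Data.Sum.Base using (inj₁; inj₂)
open import Data.Unit.Base using (⊤; tt)
open import Function.Base using (_∘_; id)
open import Function.Bundles using (_↔_; _⇔_; module Inverse)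
open import Function.Construct.Composition using (_↔-∘_)
open import Function.Construct.Identity using (↔-id)
open import Function.Construct.Symmetry using (↔-sym)
open import Function.Properties.Inverse using (↔⇒↣)
open import Level using (0ℓ)
open import Relation.Binary.Definitions using (DecidableEquality)
open import Relation.Binary.PropositionalEquality
  using (_≡_; refl; sym; trans; cong; cong₂; subst; subst₂)
open import Relation.Nullary.Decidable
  using (Dec; yes; no; does; map′; via-injection; _×-dec_)

private module ℤS = ℤSolver.+-*-Solver
open +-*-Solver using (solve; _:=_; _:+_; _:*_; :-_; _:-_; con)

------------------------------------------------------------------------
-- Elementary estimates for rationals

∣-∣<⁺ : ∀ {x ε} → x < ε → - x < ε → ∣ x ∣ < ε
∣-∣<⁺ {x} {ε} x<ε -x<ε with ℚ.∣p∣≡p∨∣p∣≡-p x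
... | inj₁ eq = subst (_< ε) (sym eq) x<ε
... | inj₂ eq = subst (_< ε) (sym eq) -x<ε

x≤∣x∣ : ∀ x → x ≤ ∣ x ∣
x≤∣x∣ x with ℚ.≤-total 0ℚ x
... | inj₁ 0≤x = ℚ.≤-reflexive (sym (ℚ.0≤p⇒∣p∣≡p 0≤x))
... | inj₂ x≤0 = ℚ.≤-trans x≤0 (ℚ.0≤∣p∣ x)

*-nonNeg : ∀ {x y} → 0ℚ ≤ x → 0ℚ ≤ y → 0ℚ ≤ x * y
*-nonNeg {x} {y} 0≤x 0≤y = ℚ.nonNegative⁻¹ (x * y)
  {{ℚ.nonNeg*nonNeg⇒nonNeg x {{ℚ.nonNegative 0≤x}} y {{ℚ.nonNegative 0≤y}}}}

+-pos : ∀ {x y} → 0ℚ < x → 0ℚ < y → 0ℚ < x + y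
+-pos {x} {y} 0<x 0<y = subst (_< x + y) (ℚ.+-identityˡ 0ℚ) (ℚ.+-mono-< 0<x 0<y)

*-pos : ∀ {x y} → 0ℚ < x → 0ℚ < y → 0ℚ < x * y
*-pos {x} {y} 0<x 0<y = ℚ.positive⁻¹ (x * y)
  {{ℚ.pos*pos⇒pos x {{ℚ.positive 0<x}} y {{ℚ.positive 0<y}}}}

-- ε divided by a positive c, presented by its defining property
quotient : ∀ {c ε} → 0ℚ < c → 0ℚ < ε → ∃[ δ ] 0ℚ < δ × c * δ ≡ ε
quotient {c} {ε} 0<c 0<ε = ℚ.1/ c * ε , *-pos 0<1/c 0<ε , eq
  where
  instance
    c-pos = ℚ.positive 0<c
    c-nonZero = ℚ.pos⇒nonZero c
  0<1/c : 0ℚ < ℚ.1/ c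
  0<1/c = ℚ.positive⁻¹ (ℚ.1/ c) {{ℚ.1/pos⇒pos c}}
  eq : c * (ℚ.1/ c * ε) ≡ ε
  eq = trans (sym (ℚ.*-assoc c (ℚ.1/ c) ε))
      (trans (cong (_* ε) (ℚ.*-inverseʳ c)) (ℚ.*-identityˡ ε))

*-mono-<-∣∣ : ∀ x {y A δ} → ∣ x ∣ < A → ∣ y ∣ < δ → 0ℚ < δ → ∣ x * y ∣ ≤ A * δ
*-mono-<-∣∣ x {y} {A} {δ} x<A y<δ 0<δ = begin
  ∣ x * y ∣      ≡⟨ ℚ.∣p*q∣≡∣p∣*∣q∣ x y ⟩
  ∣ x ∣ * ∣ y ∣  ≤⟨ ℚ.*-monoˡ-≤-nonNeg ∣ x ∣ {{ℚ.∣-∣-nonNeg x}} (ℚ.<⇒≤ y<δ) ⟩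
  ∣ x ∣ * δ      ≤⟨ ℚ.*-monoʳ-≤-nonNeg δ {{ℚ.nonNegative (ℚ.<⇒≤ 0<δ)}} (ℚ.<⇒≤ x<A) ⟩
  A * δ          ∎
  where open ℚ.≤-Reasoning

half : ∀ ε → 0ℚ < ε → ∃[ δ ] 0ℚ < δ × δ + δ ≡ ε
half ε 0<ε = ε/2 , proj₁ (proj₂ q) ,
  trans (solve 1 (λ d → d :+ d := (con 1ℚ :+ con 1ℚ) :* d) refl ε/2) (proj₂ (proj₂ q))
  where
  q = quotient {1ℚ + 1ℚ} (ℚ.positive⁻¹ (1ℚ + 1ℚ)) 0<ε
  ε/2 = proj₁ q

δ<δ+δ : ∀ {δ ε} → 0ℚ < δ → δ + δ ≡ ε → δ < ε
δ<δ+δ {δ} 0<δ eq = subst₂ _<_ (ℚ.+-identityʳ δ) eq (ℚ.+-monoʳ-< δ 0<δ)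

+-close : ∀ {δ ε} a b a′ b′ → δ + δ ≡ ε → ∣ a - a′ ∣ < δ → ∣ b - b′ ∣ < δ →
          ∣ (a + b) - (a′ + b′) ∣ < ε
+-close {δ} {ε} a b a′ b′ eq aa′ bb′ = begin-strict
  ∣ (a + b) - (a′ + b′) ∣
    ≡⟨ cong ∣_∣ (solve 4 (λ a b c d → (a :+ b) :- (c :+ d) := (a :- c) :+ (b :- d)) refl a b a′ b′) ⟩
  ∣ (a - a′) + (b - b′) ∣   ≤⟨ ℚ.∣p+q∣≤∣p∣+∣q∣ (a - a′) (b - b′) ⟩
  ∣ a - a′ ∣ + ∣ b - b′ ∣   <⟨ ℚ.+-mono-< aa′ bb′ ⟩
  δ + δ                     ≡⟨ eq ⟩
  ε                         ∎
  where open ℚ.≤-Reasoning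

-- Multiplication of rationals is uniformly continuous on bounded sets.
*-close : ∀ {A B δ} a b a′ b′ → 0ℚ < δ → ∣ a ∣ < A → ∣ b′ ∣ < B →
          ∣ a - a′ ∣ < δ → ∣ b - b′ ∣ < δ → ∣ a * b - a′ * b′ ∣ ≤ (A + B) * δ
*-close {A} {B} {δ} a b a′ b′ 0<δ a<A b′<B aa′ bb′ = begin
  ∣ a * b - a′ * b′ ∣
    ≡⟨ cong ∣_∣ (solve 4 (λ a b a′ b′ → a :* b :- a′ :* b′ :=
                 a :* (b :- b′) :+ b′ :* (a :- a′)) refl a b a′ b′) ⟩
  ∣ a * (b - b′) + b′ * (a - a′) ∣
    ≤⟨ ℚ.∣p+q∣≤∣p∣+∣q∣ (a * (b - b′)) (b′ * (a - a′)) ⟩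
  ∣ a * (b - b′) ∣ + ∣ b′ * (a - a′) ∣
    ≤⟨ ℚ.+-mono-≤ (*-mono-<-∣∣ a a<A bb′ 0<δ) (*-mono-<-∣∣ b′ b′<B aa′ 0<δ) ⟩
  A * δ + B * δ  ≡⟨ ℚ.*-distribʳ-+ δ A B ⟨
  (A + B) * δ    ∎
  where open ℚ.≤-Reasoning

------------------------------------------------------------------------
-- Real numbers: Cauchy sequences of rationals up to null sequences

record ℝ : Set where
  constructor mkℝ
  field
    seq    : ℕ → ℚ
    cauchy : ∀ ε → 0ℚ < ε → ∃[ N ] ∀ m n → N ℕ.≤ m → N ℕ.≤ n → ∣ seq m - seq n ∣ < ε

open ℝ public

infix 4 _≃_ _≤ℝ_

_≃_ : ℝ → ℝ → Set
x ≃ y = ∀ ε → 0ℚ < ε → ∃[ N ] ∀ n → N ℕ.≤ n → ∣ seq x n - seq y n ∣ < ε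

_≤ℝ_ : ℝ → ℝ → Set
x ≤ℝ y = ∀ ε → 0ℚ < ε → ∃[ N ] ∀ n → N ℕ.≤ n → seq x n < seq y n + ε

fromℚ : ℚ → ℝ
fromℚ q = mkℝ (λ _ → q) λ ε 0<ε → 0 , λ _ _ _ _ →
  subst (λ z → ∣ z ∣ < ε) (sym (ℚ.+-inverseʳ q)) 0<ε

0ℝ 1ℝ : ℝ
0ℝ = fromℚ 0ℚ
1ℝ = fromℚ 1ℚ

near⇒bounded : ∀ x c → ∣ x - c ∣ < 1ℚ → ∣ x ∣ < ∣ c ∣ + 1ℚ
near⇒bounded x c h = begin-strict
  ∣ x ∣              ≡⟨ cong ∣_∣ (solve 2 (λ a b → a := b :+ (a :- b)) refl x c) ⟩
  ∣ c + (x - c) ∣    ≤⟨ ℚ.∣p+q∣≤∣p∣+∣q∣ c (x - c) ⟩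
  ∣ c ∣ + ∣ x - c ∣  <⟨ ℚ.+-monoʳ-< ∣ c ∣ h ⟩
  ∣ c ∣ + 1ℚ         ∎
  where open ℚ.≤-Reasoning

bounded : ∀ x → ∃[ B ] ∃[ N ] 0ℚ < B × (∀ n → N ℕ.≤ n → ∣ seq x n ∣ < B)
bounded x =
  let N , close = cauchy x 1ℚ (ℚ.positive⁻¹ 1ℚ)
      c = seq x N
  in ∣ c ∣ + 1ℚ , N , ℚ.+-mono-≤-< (ℚ.0≤∣p∣ c) (ℚ.positive⁻¹ 1ℚ) ,
     λ n N≤n → near⇒bounded (seq x n) c (close n N N≤n ℕ.≤-refl)

infixl 6 _+ℝ_
infixl 7 _*ℝ_

_+ℝ_ : ℝ → ℝ → ℝ
x +ℝ y = mkℝ (λ n → seq x n + seq y n) λ ε 0<ε →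
  let δ , 0<δ , eq = half ε 0<ε
      M , xM = cauchy x δ 0<δ
      N , yN = cauchy y δ 0<δ
  in M ℕ.⊔ N , λ m n hm hn →
     +-close {δ} (seq x m) (seq y m) (seq x n) (seq y n) eq
                (xM m n (ℕ.m⊔n≤o⇒m≤o M N hm) (ℕ.m⊔n≤o⇒m≤o M N hn))
                (yN m n (ℕ.m⊔n≤o⇒n≤o M N hm) (ℕ.m⊔n≤o⇒n≤o M N hn))

_*ℝ_ : ℝ → ℝ → ℝ
x *ℝ y = mkℝ (λ n → seq x n * seq y n) λ ε 0<ε →
  let A , K , 0<A , x<A = bounded x
      B , L , 0<B , y<B = bounded y
      η , 0<η , η+η≡ε = half ε 0<ε
      δ , 0<δ , eq = quotient (+-pos 0<A 0<B) 0<η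
      M , xM = cauchy x δ 0<δ
      N , yN = cauchy y δ 0<δ
  in (K ℕ.⊔ L) ℕ.⊔ (M ℕ.⊔ N) , λ m n hm hn →
     let KL≤m = ℕ.m⊔n≤o⇒m≤o (K ℕ.⊔ L) (M ℕ.⊔ N) hm
         KL≤n = ℕ.m⊔n≤o⇒m≤o (K ℕ.⊔ L) (M ℕ.⊔ N) hn
         MN≤m = ℕ.m⊔n≤o⇒n≤o (K ℕ.⊔ L) (M ℕ.⊔ N) hm
         MN≤n = ℕ.m⊔n≤o⇒n≤o (K ℕ.⊔ L) (M ℕ.⊔ N) hn
     in ℚ.≤-<-trans
          (*-close (seq x m) (seq y m) (seq x n) (seq y n) 0<δ
            (x<A m (ℕ.m⊔n≤o⇒m≤o K L KL≤m)) (y<B n (ℕ.m⊔n≤o⇒n≤o K L KL≤n))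
            (xM m n (ℕ.m⊔n≤o⇒m≤o M N MN≤m) (ℕ.m⊔n≤o⇒m≤o M N MN≤n))
            (yN m n (ℕ.m⊔n≤o⇒n≤o M N MN≤m) (ℕ.m⊔n≤o⇒n≤o M N MN≤n)))
          (subst (_< ε) (sym eq) (δ<δ+δ 0<η η+η≡ε))

*-approx-nonNeg : ∀ {A B δ} x y → 0ℚ < A → 0ℚ < B → 0ℚ < δ → ∣ x ∣ < A → ∣ y ∣ < B →
                  0ℚ < x + δ → 0ℚ < y + δ → 0ℚ ≤ x * y + (A + B) * δ
*-approx-nonNeg {A} {B} {δ} x y 0<A 0<B 0<δ x<A y<B hx hy
  with ℚ.≤-total 0ℚ x | ℚ.≤-total 0ℚ y
... | inj₁ 0≤x | _ = begin
  0ℚ                     ≤⟨ *-nonNeg 0≤x (ℚ.<⇒≤ hy) ⟩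
  x * (y + δ)            ≡⟨ ℚ.*-distribˡ-+ x y δ ⟩
  x * y + x * δ          ≤⟨ ℚ.+-monoʳ-≤ (x * y) (ℚ.*-monoʳ-≤-nonNeg δ {{ℚ.nonNegative (ℚ.<⇒≤ 0<δ)}} x≤A+B) ⟩
  x * y + (A + B) * δ    ∎
  where
  open ℚ.≤-Reasoning
  x≤A+B : x ≤ A + B
  x≤A+B = begin
    x       ≤⟨ ℚ.≤-trans (x≤∣x∣ x) (ℚ.<⇒≤ x<A) ⟩
    A       ≡⟨ ℚ.+-identityʳ A ⟨
    A + 0ℚ  ≤⟨ ℚ.+-monoʳ-≤ A (ℚ.<⇒≤ 0<B) ⟩
    A + B   ∎
... | inj₂ x≤0 | inj₁ 0≤y = begin
  0ℚ                     ≤⟨ *-nonNeg (ℚ.<⇒≤ hx) 0≤y ⟩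
  (x + δ) * y            ≡⟨ solve 3 (λ x y δ → (x :+ δ) :* y := x :* y :+ y :* δ) refl x y δ ⟩
  x * y + y * δ          ≤⟨ ℚ.+-monoʳ-≤ (x * y) (ℚ.*-monoʳ-≤-nonNeg δ {{ℚ.nonNegative (ℚ.<⇒≤ 0<δ)}} y≤A+B) ⟩
  x * y + (A + B) * δ    ∎
  where
  open ℚ.≤-Reasoning
  y≤A+B : y ≤ A + B
  y≤A+B = begin
    y       ≤⟨ ℚ.≤-trans (x≤∣x∣ y) (ℚ.<⇒≤ y<B) ⟩
    B       ≡⟨ ℚ.+-identityˡ B ⟨
    0ℚ + B  ≤⟨ ℚ.+-monoˡ-≤ B (ℚ.<⇒≤ 0<A) ⟩
    A + B   ∎
... | inj₂ x≤0 | inj₂ y≤0 = begin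
  0ℚ                     ≡⟨ ℚ.+-identityˡ 0ℚ ⟨
  0ℚ + 0ℚ                ≤⟨ ℚ.+-mono-≤ (*-nonNeg (ℚ.neg-antimono-≤ x≤0) (ℚ.neg-antimono-≤ y≤0))
                                        (ℚ.<⇒≤ (*-pos (+-pos 0<A 0<B) 0<δ)) ⟩
  - x * - y + (A + B) * δ ≡⟨ cong (_+ (A + B) * δ) (solve 2 (λ x y → :- x :* :- y := x :* y) refl x y) ⟩
  x * y + (A + B) * δ    ∎
  where open ℚ.≤-Reasoning

fromℚ-nonNeg : ∀ q .{{_ : NonNegative q}} → 0ℝ ≤ℝ fromℚ q
fromℚ-nonNeg q ε 0<ε = 0 , λ _ _ →
  subst (_< q + ε) (ℚ.+-identityˡ 0ℚ) (ℚ.+-mono-≤-< (ℚ.nonNegative⁻¹ q) 0<ε)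

+-approx-nonNeg : ∀ {δ ε} x y → δ + δ ≡ ε → 0ℚ < x + δ → 0ℚ < y + δ → 0ℚ < x + y + ε
+-approx-nonNeg {δ} {ε} x y eq hx hy = subst (0ℚ <_)
  (trans (solve 3 (λ a b d → (a :+ d) :+ (b :+ d) := (a :+ b) :+ (d :+ d)) refl x y δ)
    (cong (λ z → x + y + z) eq))
  (+-pos hx hy)

+ℝ-nonNeg : ∀ x y → 0ℝ ≤ℝ x → 0ℝ ≤ℝ y → 0ℝ ≤ℝ x +ℝ y
+ℝ-nonNeg x y 0≤x 0≤y ε 0<ε =
  let δ , 0<δ , eq = half ε 0<ε
      M , xM = 0≤x δ 0<δ
      N , yN = 0≤y δ 0<δ
  in M ℕ.⊔ N , λ n hn →
     +-approx-nonNeg {δ} (seq x n) (seq y n) eq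
       (xM n (ℕ.m⊔n≤o⇒m≤o M N hn)) (yN n (ℕ.m⊔n≤o⇒n≤o M N hn))

*ℝ-nonNeg : ∀ x y → 0ℝ ≤ℝ x → 0ℝ ≤ℝ y → 0ℝ ≤ℝ x *ℝ y
*ℝ-nonNeg x y 0≤x 0≤y ε 0<ε =
  let A , K , 0<A , x<A = bounded x
      B , L , 0<B , y<B = bounded y
      η , 0<η , η+η≡ε = half ε 0<ε
      δ , 0<δ , eq = quotient (+-pos 0<A 0<B) 0<η
      M , xM = 0≤x δ 0<δ
      N , yN = 0≤y δ 0<δ
  in (K ℕ.⊔ L) ℕ.⊔ (M ℕ.⊔ N) , λ n hn →
     let KL≤n = ℕ.m⊔n≤o⇒m≤o (K ℕ.⊔ L) (M ℕ.⊔ N) hn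
         MN≤n = ℕ.m⊔n≤o⇒n≤o (K ℕ.⊔ L) (M ℕ.⊔ N) hn
     in ℚ.≤-<-trans
          (*-approx-nonNeg (seq x n) (seq y n) 0<A 0<B 0<δ
            (x<A n (ℕ.m⊔n≤o⇒m≤o K L KL≤n)) (y<B n (ℕ.m⊔n≤o⇒n≤o K L KL≤n))
            (xM n (ℕ.m⊔n≤o⇒m≤o M N MN≤n)) (yN n (ℕ.m⊔n≤o⇒n≤o M N MN≤n)))
          (ℚ.+-monoʳ-< (seq x n * seq y n) (subst (_< ε) (sym eq) (δ<δ+δ 0<η η+η≡ε)))

------------------------------------------------------------------------
-- Square roots of non-negative rationals

-- The largest m with m * m ≤ k.
isqrt : ℕ → ℕ
isqrt zero    = zero
isqrt (suc k) with suc (isqrt k) ℕ.* suc (isqrt k) ℕ.≤? suc k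
... | yes _ = suc (isqrt k)
... | no  _ = isqrt k

isqrt-lower : ∀ k → isqrt k ℕ.* isqrt k ℕ.≤ k
isqrt-lower zero    = z≤n
isqrt-lower (suc k) with suc (isqrt k) ℕ.* suc (isqrt k) ℕ.≤? suc k
... | yes p = p
... | no  _ = ℕ.m≤n⇒m≤1+n (isqrt-lower k)

isqrt-upper : ∀ k → k ℕ.< suc (isqrt k) ℕ.* suc (isqrt k)
isqrt-upper zero    = s≤s z≤n
isqrt-upper (suc k) with suc (isqrt k) ℕ.* suc (isqrt k) ℕ.≤? suc k
... | yes p = ℕ.≤-<-trans (isqrt-upper k)
                (ℕ.*-mono-< (ℕ.n<1+n (suc (isqrt k))) (ℕ.n<1+n (suc (isqrt k))))
... | no ¬p = ℕ.≰⇒> ¬p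

module Root (q : ℚ) .{{nn : NonNegative q}} where
  p = ℤ.∣ ↥ q ∣
  d = ↧ₙ q

  root : ℕ → ℕ
  root n = isqrt ((p ℕ.* (suc n ℕ.* suc n)) ℕ./ d)

  low high step : ℕ → ℚ
  low  n = + root n / suc n
  high n = + suc (root n) / suc n
  step n = + 1 / suc n

  lower-ℕ : ∀ n → root n ℕ.* root n ℕ.* d ℕ.≤ p ℕ.* (suc n ℕ.* suc n)
  lower-ℕ n = ℕ.≤-trans (ℕ.*-monoˡ-≤ d (isqrt-lower (P ℕ./ d))) (ℕ.m/n*n≤m P d)
    where P = p ℕ.* (suc n ℕ.* suc n)

  upper-ℕ : ∀ n → p ℕ.* (suc n ℕ.* suc n) ℕ.< suc (root n) ℕ.* suc (root n) ℕ.* d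
  upper-ℕ n = begin-strict
    P                                   ≡⟨ ℕ.m≡m%n+[m/n]*n P d ⟩
    P ℕ.% d ℕ.+ P ℕ./ d ℕ.* d           <⟨ ℕ.+-monoˡ-< (P ℕ./ d ℕ.* d) (ℕ.m%n<n P d) ⟩
    suc (P ℕ./ d) ℕ.* d                 ≤⟨ ℕ.*-monoˡ-≤ d (isqrt-upper (P ℕ./ d)) ⟩
    suc (root n) ℕ.* suc (root n) ℕ.* d ∎
    where
    open ℕ.≤-Reasoning
    P = p ℕ.* (suc n ℕ.* suc n)

  toℚᵘ-q : ℚ.toℚᵘ q ≡ ℚᵘ.mkℚᵘ (+ p) (ℚ.denominator-1 q)
  toℚᵘ-q = aux q
    where
    aux : ∀ q .{{_ : NonNegative q}} →
          ℚ.toℚᵘ q ≡ ℚᵘ.mkℚᵘ (+ ℤ.∣ ↥ q ∣) (ℚ.denominator-1 q)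
    aux (ℚ.mkℚ (+ _) _ _) = refl

  square : ∀ m n → ℚ.toℚᵘ (+ m / suc n * (+ m / suc n)) ℚᵘ.≃
                   (ℚᵘ.mkℚᵘ (+ m) n ℚᵘ.* ℚᵘ.mkℚᵘ (+ m) n)
  square m n = ℚᵘ.≃-trans (ℚ.toℚᵘ-homo-* (+ m / suc n) (+ m / suc n))
    (ℚᵘ.*-cong (ℚ.toℚᵘ-fromℚᵘ (ℚᵘ.mkℚᵘ (+ m) n)) (ℚ.toℚᵘ-fromℚᵘ (ℚᵘ.mkℚᵘ (+ m) n)))

  lhs : ∀ m → (+ m ℤ.* + m) ℤ.* + d ≡ + (m ℕ.* m ℕ.* d)
  lhs m = trans (cong (ℤ._* + d) (sym (ℤ.pos-* m m))) (sym (ℤ.pos-* (m ℕ.* m) d))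

  low² : ∀ n → low n * low n ≤ q
  low² n = ℚ.toℚᵘ-cancel-≤ (begin
    ℚ.toℚᵘ (low n * low n)                               ≃⟨ square (root n) n ⟩
    ℚᵘ.mkℚᵘ (+ root n) n ℚᵘ.* ℚᵘ.mkℚᵘ (+ root n) n       ≤⟨ ℚᵘ.*≤* (subst₂ ℤ._≤_
        (sym (lhs (root n))) (ℤ.pos-* p (suc n ℕ.* suc n)) (ℤ.+≤+ (lower-ℕ n))) ⟩
    ℚᵘ.mkℚᵘ (+ p) (ℚ.denominator-1 q)                    ≡⟨ toℚᵘ-q ⟨
    ℚ.toℚᵘ q                                             ∎)
    where open ℚᵘ.≤-Reasoning

  high² : ∀ n → q < high n * high n
  high² n = ℚ.toℚᵘ-cancel-< (begin-strict
    ℚ.toℚᵘ q                                             ≡⟨ toℚᵘ-q ⟩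
    ℚᵘ.mkℚᵘ (+ p) (ℚ.denominator-1 q)                    <⟨ ℚᵘ.*<* (subst₂ ℤ._<_
        (ℤ.pos-* p (suc n ℕ.* suc n)) (sym (lhs (suc (root n)))) (+<+ (upper-ℕ n))) ⟩
    ℚᵘ.mkℚᵘ (+ suc (root n)) n ℚᵘ.* ℚᵘ.mkℚᵘ (+ suc (root n)) n ≃⟨ square (suc (root n)) n ⟨
    ℚ.toℚᵘ (high n * high n)                             ∎)
    where open ℚᵘ.≤-Reasoning

  high≡low+step : ∀ n → high n ≡ low n + step n
  high≡low+step n = ℚ.toℚᵘ-injective (begin
    ℚ.toℚᵘ (high n)
      ≈⟨ ℚ.toℚᵘ-fromℚᵘ (ℚᵘ.mkℚᵘ (+ suc r) n) ⟩
    ℚᵘ.mkℚᵘ (+ suc r) n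
      ≈⟨ ℚᵘ.*≡* (trans (cong (ℤ._* (N ℤ.* N)) (ℤ.pos-+ 1 r))
           (ℤS.solve 2 (λ r N → (ℤS.con (+ 1) ℤS.:+ r) ℤS.:* (N ℤS.:* N) ℤS.:=
              (r ℤS.:* N ℤS.:+ ℤS.con (+ 1) ℤS.:* N) ℤS.:* N) refl (+ r) N)) ⟩
    ℚᵘ.mkℚᵘ (+ r) n ℚᵘ.+ ℚᵘ.mkℚᵘ (+ 1) n
      ≈⟨ ℚᵘ.+-cong (ℚ.toℚᵘ-fromℚᵘ (ℚᵘ.mkℚᵘ (+ r) n)) (ℚ.toℚᵘ-fromℚᵘ (ℚᵘ.mkℚᵘ (+ 1) n)) ⟨
    ℚ.toℚᵘ (low n) ℚᵘ.+ ℚ.toℚᵘ (step n)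
      ≈⟨ ℚ.toℚᵘ-homo-+ (low n) (step n) ⟨
    ℚ.toℚᵘ (low n + step n) ∎)
    where
    open import Relation.Binary.Reasoning.Setoid ℚᵘ.≃-setoid
    r = root n
    N = + suc n

  0≤low : ∀ n → 0ℚ ≤ low n
  0≤low n = ℚ.nonNegative⁻¹ (low n) {{ℚ.normalize-nonNeg (root n) (suc n)}}

  0<step : ∀ n → 0ℚ < step n
  0<step n = ℚ.positive⁻¹ (step n) {{ℚ.normalize-pos 1 (suc n)}}

  step< : ∀ ε → 0ℚ < ε → ∀ n → ↧ₙ ε ℕ.≤ n → step n < ε
  step< ε 0<ε n h = aux ε {{ℚ.positive 0<ε}} h
    where
    aux : ∀ ε .{{_ : Positive ε}} → ↧ₙ ε ℕ.≤ n → step n < ε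
    aux ε@(ℚ.mkℚ (+ suc k) d-1 _) h = ℚ.toℚᵘ-cancel-< (begin-strict
      ℚ.toℚᵘ (step n)      ≃⟨ ℚ.toℚᵘ-fromℚᵘ (ℚᵘ.mkℚᵘ (+ 1) n) ⟩
      ℚᵘ.mkℚᵘ (+ 1) n      <⟨ ℚᵘ.*<* (subst₂ ℤ._<_ (sym (ℤ.*-identityˡ (+ suc d-1)))
                                (ℤ.pos-* (suc k) (suc n))
                                (+<+ (ℕ.<-≤-trans (s≤s h) (ℕ.m≤n*m (suc n) (suc k))))) ⟩
      ℚ.toℚᵘ ε             ∎)
      where open ℚᵘ.≤-Reasoning

  low<high : ∀ m n → low m < high n
  low<high m n = ℚ.≰⇒> λ high≤low → ℚ.<-irrefl refl (ℚ.<-≤-trans (high² n) (ℚ.≤-trans (begin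
    high n * high n  ≤⟨ ℚ.*-monoˡ-≤-nonNeg (high n) {{ℚ.normalize-nonNeg (suc (root n)) (suc n)}} high≤low ⟩
    high n * low m   ≤⟨ ℚ.*-monoʳ-≤-nonNeg (low m) {{ℚ.nonNegative (0≤low m)}} high≤low ⟩
    low m * low m    ∎) (low² m)))
    where open ℚ.≤-Reasoning

  low-low< : ∀ ε → 0ℚ < ε → ∀ m n → ↧ₙ ε ℕ.≤ n → low m - low n < ε
  low-low< ε 0<ε m n h = begin-strict
    low m - low n            <⟨ ℚ.+-monoˡ-< (- low n) (low<high m n) ⟩
    high n - low n           ≡⟨ cong (_- low n) (high≡low+step n) ⟩
    low n + step n - low n   ≡⟨ solve 2 (λ a b → a :+ b :- a := b) refl (low n) (step n) ⟩
    step n                   <⟨ step< ε 0<ε n h ⟩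
    ε                        ∎
    where open ℚ.≤-Reasoning

  root-cauchy : ∀ ε → 0ℚ < ε → ∃[ N ] ∀ m n → N ℕ.≤ m → N ℕ.≤ n → ∣ low m - low n ∣ < ε
  root-cauchy ε 0<ε = ↧ₙ ε , λ m n hm hn → ∣-∣<⁺ (low-low< ε 0<ε m n hn)
    (subst (_< ε) (solve 2 (λ a b → a :- b := :- (b :- a)) refl (low n) (low m))
      (low-low< ε 0<ε n m hm))

-- The n-th approximation is the largest multiple of 1/(n+1) whose square is
-- at most q.
√ : (q : ℚ) .{{_ : NonNegative q}} → ℝ
√ q = mkℝ
  (λ n → + isqrt ((ℤ.∣ ↥ q ∣ ℕ.* (suc n ℕ.* suc n)) ℕ./ ↧ₙ q) / suc n)
  (Root.root-cauchy q)

√-nonNeg : ∀ q .{{_ : NonNegative q}} → 0ℝ ≤ℝ √ q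
√-nonNeg q ε 0<ε = 0 , λ n _ →
  subst (_< seq (√ q) n + ε) (ℚ.+-identityˡ 0ℚ) (ℚ.+-mono-≤-< (Root.0≤low q n) 0<ε)

square-close : ∀ {q l h B δ ε} → 0ℚ < B → 0ℚ < h → 0ℚ < ε → (B + B + 1ℚ) * δ ≡ ε →
               l * l ≤ q → q < (l + h) * (l + h) → ∣ l ∣ < B → h < δ → h < 1ℚ →
               ∣ l * l - q ∣ < ε
square-close {q} {l} {h} {B} {δ} {ε} 0<B 0<h 0<ε eq l²≤q q<u² l<B h<δ h<1 =
  ∣-∣<⁺ below (subst (_< ε) (solve 2 (λ a b → a :- b := :- (b :- a)) refl q (l * l)) above)
  where
  open ℚ.≤-Reasoning
  l≤B : l ≤ B
  l≤B = ℚ.≤-trans (x≤∣x∣ l) (ℚ.<⇒≤ l<B)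
  above : q - l * l < ε
  above = begin-strict
    q - l * l                  <⟨ ℚ.+-monoˡ-< (- (l * l)) q<u² ⟩
    (l + h) * (l + h) - l * l
      ≡⟨ solve 2 (λ l h → (l :+ h) :* (l :+ h) :- l :* l := (l :+ l :+ h) :* h) refl l h ⟩
    (l + l + h) * h            ≤⟨ ℚ.*-monoʳ-≤-nonNeg h {{ℚ.nonNegative (ℚ.<⇒≤ 0<h)}}
                                    (ℚ.+-mono-≤ (ℚ.+-mono-≤ l≤B l≤B) (ℚ.<⇒≤ h<1)) ⟩
    (B + B + 1ℚ) * h           <⟨ ℚ.*-monoʳ-<-pos (B + B + 1ℚ)
                                    {{ℚ.positive (+-pos (+-pos 0<B 0<B) (ℚ.positive⁻¹ 1ℚ))}} h<δ ⟩
    (B + B + 1ℚ) * δ           ≡⟨ eq ⟩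
    ε                          ∎
  below : l * l - q < ε
  below = ℚ.≤-<-trans
    (subst (l * l - q ≤_) (ℚ.+-inverseʳ q) (ℚ.+-monoˡ-≤ (- q) l²≤q)) 0<ε

√-square : ∀ q .{{_ : NonNegative q}} → √ q *ℝ √ q ≃ fromℚ q
√-square q ε 0<ε =
  let open Root q
      B , K , 0<B , low<B = bounded (√ q)
      δ , 0<δ , eq = quotient (+-pos (+-pos 0<B 0<B) (ℚ.positive⁻¹ 1ℚ)) 0<ε
  in K ℕ.⊔ (↧ₙ δ ℕ.⊔ 1) , λ n hn →
     let hn′ = ℕ.m⊔n≤o⇒n≤o K (↧ₙ δ ℕ.⊔ 1) hn
     in square-close {q} {low n} {step n} 0<B (0<step n) 0<ε eq (low² n)
          (subst (λ z → q < z * z) (high≡low+step n) (high² n))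
          (low<B n (ℕ.m⊔n≤o⇒m≤o K (↧ₙ δ ℕ.⊔ 1) hn))
          (step< δ 0<δ n (ℕ.m⊔n≤o⇒m≤o (↧ₙ δ) 1 hn′))
          (step< 1ℚ (ℚ.positive⁻¹ 1ℚ) n (ℕ.m⊔n≤o⇒n≤o (↧ₙ δ) 1 hn′))

------------------------------------------------------------------------
-- Non-negative reals

record ℝ≥0 : Set where
  constructor mkℝ≥0
  field
    value  : ℝ
    nonNeg : 0ℝ ≤ℝ value

open ℝ≥0 public

ℝ≥0-rawSemiring : RawSemiring 0ℓ 0ℓ
ℝ≥0-rawSemiring = record
  { Carrier = ℝ≥0
  ; _≈_     = λ x y → value x ≃ value y
  ; _+_     = λ x y → mkℝ≥0 (value x +ℝ value y)
                            (+ℝ-nonNeg (value x) (value y) (nonNeg x) (nonNeg y))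
  ; _*_     = λ x y → mkℝ≥0 (value x *ℝ value y)
                            (*ℝ-nonNeg (value x) (value y) (nonNeg x) (nonNeg y))
  ; 0#      = mkℝ≥0 0ℝ (fromℚ-nonNeg 0ℚ)
  ; 1#      = mkℝ≥0 1ℝ (fromℚ-nonNeg 1ℚ)
  }

module ℝ≥0-Ops = RawSemiring ℝ≥0-rawSemiring

fromℕ : ℕ → ℝ≥0
fromℕ n = mkℝ≥0 (fromℚ (+ n / 1)) (fromℚ-nonNeg (+ n / 1) {{ℚ.normalize-nonNeg n 1}})

√[_/_] : (m n : ℕ) .{{_ : ℕ.NonZero n}} → ℝ≥0
√[ m / n ] = mkℝ≥0 (√ (+ m / n) {{pf}}) (√-nonNeg (+ m / n) {{pf}})
  where
  pf : NonNegative (+ m / n)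
  pf = ℚ.normalize-nonNeg m n

------------------------------------------------------------------------
-- Finite sets

-- Without eta and with products given by copatterns, X ⊗₀ Y does not unfold
-- during unification, so the implicit objects of matrices are inferred.
record FinSet : Set₁ where
  no-eta-equality
  field
    Carrier : Set
    size    : ℕ
    enum    : Fin size ↔ Carrier

  element : Fin size → Carrier
  element = Inverse.to enum

  _≟_ : DecidableEquality Carrier
  _≟_ = via-injection (↔⇒↣ (↔-sym enum)) Fin._≟_

open FinSet public using (Carrier)

infixr 7 _⊗₀_

_⊗₀_ : FinSet → FinSet → FinSet
Carrier (X ⊗₀ Y)     = Carrier X × Carrier Y
FinSet.size (X ⊗₀ Y) = FinSet.size X ℕ.* FinSet.size Y
FinSet.enum (X ⊗₀ Y) = (FinSet.enum X ×-↔ FinSet.enum Y) ↔-∘ Fin.*↔×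

I₀ : FinSet
Carrier I₀     = ⊤
FinSet.size I₀ = 1
FinSet.enum I₀ = Fin.1↔⊤

count : (X : FinSet) {P : Carrier X → Set} → (∀ x → Dec (P x)) → ℕ
count X P? = sum (λ i → if does (P? (FinSet.element X i)) then 1 else 0)
  where open RawMonoidDefs ℕ.+-0-rawMonoid using (sum)

count-nonZero : ∀ X {P : Carrier X → Set} (P? : ∀ x → Dec (P x)) →
                ∀ x → P x → ℕ.NonZero (count X P?)
count-nonZero X {P} P? x Px = aux _ (from x) (subst P (sym (strictlyInverseˡ x)) Px)
  where
  open Inverse (FinSet.enum X) using (from; strictlyInverseˡ)
  open RawMonoidDefs ℕ.+-0-rawMonoid using (sum)
  aux : ∀ n {f : Fin n → Carrier X} (i : Fin n) → P (f i) →
        ℕ.NonZero (sum (λ j → if does (P? (f j)) then 1 else 0))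
  aux (suc n) {f} i p with P? (f zero)
  ... | yes _ = _
  aux (suc n) {f} zero    p | no ¬p with () ← ¬p p
  aux (suc n) {f} (suc i) p | no _  = aux n {f ∘ suc} i p

------------------------------------------------------------------------
-- The category Mat of finite sets and matrices over ℝ≥0

-- The entry f_x^y is  entry f x y.
record Mat (X Y : FinSet) : Set where
  constructor mat
  field
    entry : Carrier X → Carrier Y → ℝ≥0

open Mat public

infix 4 _≈_

record _≈_ {X Y : FinSet} (f g : Mat X Y) : Set where
  constructor pointwise
  field
    entrywise : ∀ x y → entry f x y ℝ≥0-Ops.≈ entry g x y

open _≈_ public

infixr 9 _∘ₘ_

_∘ₘ_ : ∀ {X Y Z} → Mat Y Z → Mat X Y → Mat X Z
entry (_∘ₘ_ {Y = Y} g f) a c =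
  sum (λ i → entry f a (element i) ℝ≥0-Ops.* entry g (element i) c)
  where
  open FinSet Y using (element)
  open RawMonoidDefs ℝ≥0-Ops.+-rawMonoid using (sum)

infixr 10 _⊗_

_⊗_ : ∀ {X Y Z W} → Mat X Y → Mat Z W → Mat (X ⊗₀ Z) (Y ⊗₀ W)
entry (f ⊗ g) (a , c) (b , d) = entry f a b ℝ≥0-Ops.* entry g c d

infix 11 _†

_† : ∀ {X Y} → Mat X Y → Mat Y X
entry (f †) y x = entry f x y

-- The matrix of a function between finite sets.
⟪_⟫ : ∀ {X Y} → (Carrier X → Carrier Y) → Mat X Y
entry (⟪_⟫ {Y = Y} f) x y =
  if does (FinSet._≟_ Y (f x) y) then ℝ≥0-Ops.1# else ℝ≥0-Ops.0#

idₘ : ∀ X → Mat X X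
idₘ X = ⟪ id ⟫

α : ∀ X Y Z → Mat ((X ⊗₀ Y) ⊗₀ Z) (X ⊗₀ (Y ⊗₀ Z))
α X Y Z = ⟪ assocʳ ⟫

α⁻¹ : ∀ X Y Z → Mat (X ⊗₀ (Y ⊗₀ Z)) ((X ⊗₀ Y) ⊗₀ Z)
α⁻¹ X Y Z = ⟪ assocˡ ⟫

λₘ : ∀ X → Mat (I₀ ⊗₀ X) X
λₘ X = ⟪ proj₂ ⟫

ρₘ : ∀ X → Mat (X ⊗₀ I₀) X
ρₘ X = ⟪ proj₁ ⟫

record IsMonoid (S : FinSet) (μ : Mat (S ⊗₀ S) S) (e : Mat I₀ S) : Set where
  field
    assoc     : μ ∘ₘ (μ ⊗ idₘ S) ≈ μ ∘ₘ (idₘ S ⊗ μ) ∘ₘ α S S S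
    identityˡ : μ ∘ₘ (e ⊗ idₘ S) ≈ λₘ S
    identityʳ : μ ∘ₘ (idₘ S ⊗ e) ≈ ρₘ S

record IsDaggerFrobenius (S : FinSet) (μ : Mat (S ⊗₀ S) S) (e : Mat I₀ S) : Set where
  field
    isMonoid   : IsMonoid S μ e
    frobeniusˡ : (μ ⊗ idₘ S) ∘ₘ α⁻¹ S S S ∘ₘ (idₘ S ⊗ μ †) ≈ μ † ∘ₘ μ
    frobeniusʳ : μ † ∘ₘ μ ≈ (idₘ S ⊗ μ) ∘ₘ α S S S ∘ₘ (μ † ⊗ idₘ S)

------------------------------------------------------------------------
-- Coherent configurations

-- A partition of A: Block indexes the parts, and a ∋ p is membership.
record Partition (A : FinSet) : Set₁ where
  infix 4 _∋_ _∋?_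
  field
    Block    : FinSet
    _∋_      : Carrier Block → Carrier A → Set
    nonempty : ∀ a → ∃[ p ] a ∋ p
    covers   : ∀ p → ∃! _≡_ (λ a → a ∋ p)

  _∋?_ : ∀ a p → Dec (a ∋ p)
  a ∋? p with covers p
  ... | b , b∋p , unique = map′ (λ b≡a → subst (_∋ p) b≡a b∋p) unique (FinSet._≟_ Block b a)

record CoherentConfiguration : Set₁ where
  field
    X         : FinSet
    partition : Partition (X ⊗₀ X)

  open Partition partition public renaming (Block to S)

  -- the number of z joining x to y through a and then b
  paths : (a b : Carrier S) → Carrier X × Carrier X → ℕ
  paths a b (x , y) = count X (λ z → (a ∋? (x , z)) ×-dec (b ∋? (z , y)))

  field
    diagonal : ∀ a x → a ∋ (x , x) → ∀ {y z} → a ∋ (y , z) → y ≡ z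
    coherent : ∀ a b c {p q} → c ∋ p → c ∋ q → paths a b p ≡ paths a b q
    converse : ∀ c → ∃[ c′ ] ∀ x y → c′ ∋ (y , x) ⇔ c ∋ (x , y)

  ∇ : (a b c : Carrier S) → ℕ
  ∇ a b c = paths a b (proj₁ (nonempty c))

  ‖_‖ : Carrier S → ℕ
  ‖ a ‖ = count X (λ y → a ∋? (proj₁ (proj₁ (nonempty a)) , y))

  ‖‖-nonZero : ∀ a → ℕ.NonZero ‖ a ‖
  ‖‖-nonZero a with nonempty a
  ... | (x , y) , a∋xy = count-nonZero X (λ z → a ∋? (x , z)) y a∋xy

  ∇̇ : Mat (S ⊗₀ S) S
  entry ∇̇ (a , b) c = √[ ‖ c ‖ / ‖ a ‖ ℕ.* ‖ b ‖ ] {{nz}} ℝ≥0-Ops.* fromℕ (∇ a b c)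
    where
    nz : ℕ.NonZero (‖ a ‖ ℕ.* ‖ b ‖)
    nz = ℕ.m*n≢0 ‖ a ‖ ‖ b ‖ {{‖‖-nonZero a}} {{‖‖-nonZero b}}

  _⊆id? : ∀ a → Dec (∀ x y → a ∋ (x , y) → x ≡ y)
  a ⊆id? with nonempty a
  ... | (x , y) , a∋xy with FinSet._≟_ X x y
  ...   | yes refl = yes λ _ _ → diagonal a x a∋xy
  ...   | no  x≢y  = no λ a⊆id → x≢y (a⊆id x y a∋xy)

  e : Mat I₀ S
  entry e tt a = if does (a ⊆id?) then ℝ≥0-Ops.1# else ℝ≥0-Ops.0#

{-# OPTIONS --safe #-}
-- Write ∇̇_ab^c = s c · r a · r b · ∇_ab^c with s a = √‖a‖ and r a = 1/√‖a‖.
-- Since s t · r t = 1 and s t · s t = ‖t‖, every entry of the two sides of an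
-- axiom is a product of factors r and s that does not depend on the summation
-- index, times a natural number, so the axioms reduce to identities for
-- structure constants.  Associativity counts paths of length three.  For the
-- Frobenius law one fixes a source x of a: both sides count the quadrilaterals
-- x → u → y, x → v → y of types a, b and c, d, sorted by the type of x → y on
-- one side and by that of u → v on the other.  The valencies enter through
-- ‖c‖ ∇_ab^c = #{y : (x,y) ∈ c} · ∇_ab^c, valid at every source x of a, because
-- the number of c-successors of a point depends only on the class of its loop.
module Submission where

open import Defs
open import Algebra.Bundles using (CommutativeSemiring)
open import Algebra.Bundles.Raw using (RawSemiring)
import Algebra.Properties.CommutativeSemigroup as CommutativeSemigroupProperties
import Algebra.Properties.Semiring.Sum as SemiringSum
import Algebra.Solver.CommutativeMonoid as CommutativeMonoidSolver
open import Algebra.Structures.Biased using (isCommutativeSemiringˡ; isCommutativeMonoidˡ)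
open import Data.Bool.Base using (if_then_else_)
open import Data.Empty using (⊥-elim)
open import Data.Fin.Base as Fin using (Fin; zero; suc)
import Data.Fin.Properties as Fin
open import Data.Nat.Base as ℕ using (ℕ; zero; suc)
import Data.Nat.Properties as ℕ
open import Data.Product using (_×_; _,_; proj₁; proj₂; ∃-syntax; assocʳ; assocˡ)
open import Data.Unit.Base using (tt)
open import Function.Base using (_∘_; id)
open import Function.Bundles using (module Inverse; module Equivalence)
open import Level using (0ℓ)
open import Relation.Binary.PropositionalEquality as ≡ using (_≡_; _≢_; module ≡-Reasoning)
import Relation.Binary.Reasoning.Setoid as SetoidReasoning
open import Relation.Binary.Structures using (IsEquivalence)
open import Relation.Nullary.Decidable using (Dec; yes; no; does; _×-dec_)
open import Relation.Nullary.Negation using (¬_)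
open ℝ≥0-Ops using () renaming (_≈_ to _≈⁺_; _+_ to _+⁺_; _*_ to _*⁺_; 0# to 0⁺; 1# to 1⁺)

-- Arithmetic of non-negative reals

module _ where
  open import Data.Integer.Base as ℤ using (+_)
  import Data.Integer.Properties as ℤ
  open import Data.Rational.Base as ℚ
    using (0ℚ; _/_; _<_; _≤_; _+_; _*_; _-_; -_; ∣_∣)
  import Data.Rational.Properties as ℚ
  open import Data.Rational.Solver using (module +-*-Solver)
  import Data.Rational.Unnormalised.Base as ℚᵘ
  import Data.Rational.Unnormalised.Properties as ℚᵘ
  open import Relation.Binary.PropositionalEquality
    using (refl; sym; trans; cong; cong₂; subst; subst₂)
  open +-*-Solver using (solve; _:=_; _:+_; _:*_; _:-_; :-_)

  ≗⇒≃ : ∀ {x y} → (∀ n → seq x n ≡ seq y n) → x ≃ y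
  ≗⇒≃ {x} {y} x≗y ε 0<ε = 0 , λ n _ → subst (λ z → ∣ z ∣ < ε)
    (sym (trans (cong (_- seq y n) (x≗y n)) (ℚ.+-inverseʳ (seq y n)))) 0<ε

  ∣-∣-comm : ∀ p q → ∣ p - q ∣ ≡ ∣ q - p ∣
  ∣-∣-comm p q = trans (sym (ℚ.∣-p∣≡∣p∣ (p - q)))
    (cong ∣_∣ (solve 2 (λ a b → :- (a :- b) := b :- a) refl p q))

  ≃-refl : ∀ {x} → x ≃ x
  ≃-refl {x} = ≗⇒≃ {x} {x} λ _ → refl

  ≃-sym : ∀ {x y} → x ≃ y → y ≃ x
  ≃-sym {x} {y} x≃y ε 0<ε = let N , close = x≃y ε 0<ε in N , λ n N≤n →
    subst (_< ε) (∣-∣-comm (seq x n) (seq y n)) (close n N≤n)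

  ≃-trans : ∀ {x y z} → x ≃ y → y ≃ z → x ≃ z
  ≃-trans {x} {y} {z} x≃y y≃z ε 0<ε =
    let δ , 0<δ , eq = half ε 0<ε
        M , xM = x≃y δ 0<δ
        N , yN = y≃z δ 0<δ
    in M ℕ.⊔ N , λ n hn → subst (_< ε)
       (cong ∣_∣ (solve 3 (λ a b c → (a :+ b) :- (b :+ c) := a :- c) refl (seq x n) (seq y n) (seq z n)))
       (+-close {δ} (seq x n) (seq y n) (seq y n) (seq z n) eq
         (xM n (ℕ.m⊔n≤o⇒m≤o M N hn)) (yN n (ℕ.m⊔n≤o⇒n≤o M N hn)))

  +ℝ-cong : ∀ {x x′ y y′} → x ≃ x′ → y ≃ y′ → x +ℝ y ≃ x′ +ℝ y′
  +ℝ-cong {x} {x′} {y} {y′} x≃x′ y≃y′ ε 0<ε =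
    let δ , 0<δ , eq = half ε 0<ε
        M , xM = x≃x′ δ 0<δ
        N , yN = y≃y′ δ 0<δ
    in M ℕ.⊔ N , λ n hn →
       +-close {δ} (seq x n) (seq y n) (seq x′ n) (seq y′ n) eq
         (xM n (ℕ.m⊔n≤o⇒m≤o M N hn)) (yN n (ℕ.m⊔n≤o⇒n≤o M N hn))

  *ℝ-cong : ∀ {x x′ y y′} → x ≃ x′ → y ≃ y′ → x *ℝ y ≃ x′ *ℝ y′
  *ℝ-cong {x} {x′} {y} {y′} x≃x′ y≃y′ ε 0<ε =
    let A , K , 0<A , x<A = bounded x
        B , L , 0<B , y′<B = bounded y′
        η , 0<η , η+η≡ε = half ε 0<ε
        δ , 0<δ , eq = quotient (+-pos 0<A 0<B) 0<η
        M , xM = x≃x′ δ 0<δ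
        N , yN = y≃y′ δ 0<δ
    in (K ℕ.⊔ L) ℕ.⊔ (M ℕ.⊔ N) , λ n hn →
       let KL≤n = ℕ.m⊔n≤o⇒m≤o (K ℕ.⊔ L) (M ℕ.⊔ N) hn
           MN≤n = ℕ.m⊔n≤o⇒n≤o (K ℕ.⊔ L) (M ℕ.⊔ N) hn
       in ℚ.≤-<-trans
            (*-close (seq x n) (seq y n) (seq x′ n) (seq y′ n) 0<δ
              (x<A n (ℕ.m⊔n≤o⇒m≤o K L KL≤n)) (y′<B n (ℕ.m⊔n≤o⇒n≤o K L KL≤n))
              (xM n (ℕ.m⊔n≤o⇒m≤o M N MN≤n)) (yN n (ℕ.m⊔n≤o⇒n≤o M N MN≤n)))
            (subst (_< ε) (sym eq) (δ<δ+δ 0<η η+η≡ε))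

  ≈⁺-isEquivalence : IsEquivalence _≈⁺_
  ≈⁺-isEquivalence = record
    { refl  = λ {x} → ≃-refl {value x}
    ; sym   = λ {x} {y} → ≃-sym {value x} {value y}
    ; trans = λ {x} {y} {z} → ≃-trans {value x} {value y} {value z}
    }

  ≗⇒≈⁺ : ∀ {x y} → (∀ n → seq (value x) n ≡ seq (value y) n) → x ≈⁺ y
  ≗⇒≈⁺ {x} {y} = ≗⇒≃ {value x} {value y}

  -- Every ring law holds already term by term for the rational sequences; only equivalence and
  -- congruence involve limits.
  ℝ≥0-commutativeSemiring : CommutativeSemiring 0ℓ 0ℓ
  ℝ≥0-commutativeSemiring = record
    { RawSemiring ℝ≥0-rawSemiring
    ; isCommutativeSemiring = isCommutativeSemiringˡ (record
      { +-isCommutativeMonoid = isCommutativeMonoidˡ (record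
        { isSemigroup = record
          { isMagma = record
            { isEquivalence = ≈⁺-isEquivalence
            ; ∙-cong = λ {x} {x′} {y} {y′} →
                +ℝ-cong {value x} {value x′} {value y} {value y′}
            }
          ; assoc = λ x y z → ≗⇒≈⁺ {(x +⁺ y) +⁺ z} {x +⁺ (y +⁺ z)}
              λ n → ℚ.+-assoc (seq (value x) n) (seq (value y) n) (seq (value z) n)
          }
        ; identityˡ = λ x → ≗⇒≈⁺ {0⁺ +⁺ x} {x} λ n → ℚ.+-identityˡ (seq (value x) n)
        ; comm = λ x y → ≗⇒≈⁺ {x +⁺ y} {y +⁺ x}
            λ n → ℚ.+-comm (seq (value x) n) (seq (value y) n)
        })
      ; *-isCommutativeMonoid = isCommutativeMonoidˡ (record
        { isSemigroup = record
          { isMagma = record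
            { isEquivalence = ≈⁺-isEquivalence
            ; ∙-cong = λ {x} {x′} {y} {y′} →
                *ℝ-cong {value x} {value x′} {value y} {value y′}
            }
          ; assoc = λ x y z → ≗⇒≈⁺ {(x *⁺ y) *⁺ z} {x *⁺ (y *⁺ z)}
              λ n → ℚ.*-assoc (seq (value x) n) (seq (value y) n) (seq (value z) n)
          }
        ; identityˡ = λ x → ≗⇒≈⁺ {1⁺ *⁺ x} {x} λ n → ℚ.*-identityˡ (seq (value x) n)
        ; comm = λ x y → ≗⇒≈⁺ {x *⁺ y} {y *⁺ x}
            λ n → ℚ.*-comm (seq (value x) n) (seq (value y) n)
        })
      ; distribʳ = λ x y z → ≗⇒≈⁺ {(y +⁺ z) *⁺ x} {(y *⁺ x) +⁺ (z *⁺ x)}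
          λ n → ℚ.*-distribʳ-+ (seq (value x) n) (seq (value y) n) (seq (value z) n)
      ; zeroˡ = λ x → ≗⇒≈⁺ {0⁺ *⁺ x} {0⁺} λ n → ℚ.*-zeroˡ (seq (value x) n)
      })
    }

  -- A non-negative real may have slightly negative approximations, so only y > -δ is assumed. With
  -- ε = 4δ this still gives x + y = (x - y) + 2y ≥ 4δ - 2δ = 2δ, which bounds the second factor of
  -- x² - y² = (x - y)(x + y).
  square-gap : ∀ x y {δ ε} → 0ℚ < δ → 0ℚ < ε → (δ + δ) + (δ + δ) ≡ ε →
               0ℚ < y + δ → ε ≤ x - y → ε * (δ + δ) ≤ x * x - y * y
  square-gap x y {δ} {ε} 0<δ 0<ε 4δ≡ε 0<y+δ ε≤x-y = begin
    ε * (δ + δ)        ≤⟨ ℚ.*-monoʳ-≤-nonNeg (δ + δ) {{ℚ.nonNegative (ℚ.<⇒≤ (+-pos 0<δ 0<δ))}} ε≤x-y ⟩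
    (x - y) * (δ + δ)  ≤⟨ ℚ.*-monoˡ-≤-nonNeg (x - y) {{ℚ.nonNegative (ℚ.≤-trans (ℚ.<⇒≤ 0<ε) ε≤x-y)}} 2δ≤x+y ⟩
    (x - y) * (x + y)  ≡⟨ solve 2 (λ a b → (a :- b) :* (a :+ b) := a :* a :- b :* b) refl x y ⟩
    x * x - y * y      ∎
    where
    open ℚ.≤-Reasoning
    2δ≤x+y : δ + δ ≤ x + y
    2δ≤x+y = begin
      δ + δ
        ≡⟨ solve 1 (λ d → d :+ d := ((d :+ d) :+ (d :+ d)) :+ (:- d :+ :- d)) refl δ ⟩
      (δ + δ) + (δ + δ) + (- δ + - δ)
        ≡⟨ cong (_+ (- δ + - δ)) 4δ≡ε ⟩
      ε + (- δ + - δ)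
        ≤⟨ ℚ.+-mono-≤ ε≤x-y (ℚ.+-mono-≤ -δ≤y -δ≤y) ⟩
      (x - y) + (y + y)
        ≡⟨ solve 2 (λ a b → (a :- b) :+ (b :+ b) := a :+ b) refl x y ⟩
      x + y ∎
      where
      -δ≤y : - δ ≤ y
      -δ≤y = subst₂ _≤_ (ℚ.+-identityˡ (- δ))
        (solve 2 (λ a b → a :+ b :+ :- b := a) refl y δ)
        (ℚ.+-monoˡ-≤ (- δ) (ℚ.<⇒≤ 0<y+δ))

  -- This reduces identities between square roots to identities between rationals. Approximations
  -- that are ε apart would have squares at least 2δε apart, where δ = ε/4, and the equality of the
  -- squares excludes this from some index on.
  square-cancel-≈ : ∀ {x y} → x *⁺ x ≈⁺ y *⁺ y → x ≈⁺ y
  square-cancel-≈ {x} {y} x²≈y² ε 0<ε =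
    let η , 0<η , 2η≡ε = half ε 0<ε
        δ , 0<δ , 2δ≡η = half η 0<η
        4δ≡ε = trans (cong₂ _+_ 2δ≡η 2δ≡η) 2η≡ε
        K , hK = nonNeg x δ 0<δ
        L , hL = nonNeg y δ 0<δ
        M , hM = x²≈y² (ε * (δ + δ)) (*-pos 0<ε (+-pos 0<δ 0<δ))
    in (K ℕ.⊔ L) ℕ.⊔ M , λ n hn →
       let KL≤n = ℕ.m⊔n≤o⇒m≤o (K ℕ.⊔ L) M hn
           a = seq (value x) n
           b = seq (value y) n
           close = hM n (ℕ.m⊔n≤o⇒n≤o (K ℕ.⊔ L) M hn)
       in ∣-∣<⁺
            (one-sided 0<δ 4δ≡ε a b (hL n (ℕ.m⊔n≤o⇒n≤o K L KL≤n)) close)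
            (subst (_< ε) (solve 2 (λ a b → b :- a := :- (a :- b)) refl a b)
              (one-sided 0<δ 4δ≡ε b a (hK n (ℕ.m⊔n≤o⇒m≤o K L KL≤n))
                (subst (_< ε * (δ + δ)) (∣-∣-comm (a * a) (b * b)) close)))
    where
    one-sided : ∀ {δ} → 0ℚ < δ → (δ + δ) + (δ + δ) ≡ ε → ∀ a b → 0ℚ < b + δ →
                ∣ a * a - b * b ∣ < ε * (δ + δ) → a - b < ε
    one-sided 0<δ 4δ≡ε a b 0<b+δ close = ℚ.≰⇒> λ ε≤a-b → ℚ.<-irrefl refl
      (ℚ.≤-<-trans (square-gap a b 0<δ 0<ε 4δ≡ε 0<b+δ ε≤a-b)
        (ℚ.≤-<-trans (x≤∣x∣ (a * a - b * b)) close))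

  -- Fractions and their square roots

  /-* : ∀ m m′ n n′ .{{_ : ℕ.NonZero n}} .{{_ : ℕ.NonZero n′}} .{{_ : ℕ.NonZero (n ℕ.* n′)}} →
        (+ m / n) * (+ m′ / n′) ≡ + (m ℕ.* m′) / (n ℕ.* n′)
  /-* m m′ (suc n) (suc n′) = ℚ.toℚᵘ-injective (begin
    ℚ.toℚᵘ ((+ m / suc n) * (+ m′ / suc n′))
      ≈⟨ ℚ.toℚᵘ-homo-* (+ m / suc n) (+ m′ / suc n′) ⟩
    ℚ.toℚᵘ (+ m / suc n) ℚᵘ.* ℚ.toℚᵘ (+ m′ / suc n′)
      ≈⟨ ℚᵘ.*-cong (ℚ.toℚᵘ-fromℚᵘ p) (ℚ.toℚᵘ-fromℚᵘ p′) ⟩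
    p ℚᵘ.* p′
      -- `mkℚᵘ` stores the denominator minus one, and (n + 1)(n′ + 1) - 1 = n′ + n(n′ + 1).
      ≡⟨ cong (λ k → ℚᵘ.mkℚᵘ k (n′ ℕ.+ n ℕ.* suc n′)) (ℤ.pos-* m m′) ⟨
    ℚᵘ.mkℚᵘ (+ (m ℕ.* m′)) (n′ ℕ.+ n ℕ.* suc n′)
      ≈⟨ ℚ.toℚᵘ-fromℚᵘ (ℚᵘ.mkℚᵘ (+ (m ℕ.* m′)) (n′ ℕ.+ n ℕ.* suc n′)) ⟨
    ℚ.toℚᵘ (+ (m ℕ.* m′) / (suc n ℕ.* suc n′)) ∎)
    where
    open SetoidReasoning ℚᵘ.≃-setoid
    p  = ℚᵘ.mkℚᵘ (+ m) n
    p′ = ℚᵘ.mkℚᵘ (+ m′) n′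

  /-≡ : ∀ m m′ n n′ .{{_ : ℕ.NonZero n}} .{{_ : ℕ.NonZero n′}} →
        m ℕ.* n′ ≡ m′ ℕ.* n → + m / n ≡ + m′ / n′
  /-≡ m m′ (suc n) (suc n′) eq = ℚ.fromℚᵘ-cong {ℚᵘ.mkℚᵘ (+ m) n} {ℚᵘ.mkℚᵘ (+ m′) n′}
    (ℚᵘ.*≡* (trans (sym (ℤ.pos-* m (suc n′))) (trans (cong +_ eq) (ℤ.pos-* m′ (suc n)))))

  /1-+ : ∀ m n → + (m ℕ.+ n) / 1 ≡ + m / 1 + + n / 1
  /1-+ m n = ℚ.toℚᵘ-injective (begin
    ℚ.toℚᵘ (+ (m ℕ.+ n) / 1)          ≈⟨ ℚ.toℚᵘ-fromℚᵘ (ℚᵘ.mkℚᵘ (+ (m ℕ.+ n)) 0) ⟩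
    ℚᵘ.mkℚᵘ (+ (m ℕ.+ n)) 0           ≈⟨ ℚᵘ.*≡* (cong (ℤ._* + 1)
                                           (sym (cong₂ ℤ._+_ (ℤ.*-identityʳ (+ m)) (ℤ.*-identityʳ (+ n))))) ⟩
    ℚᵘ.mkℚᵘ (+ m) 0 ℚᵘ.+ ℚᵘ.mkℚᵘ (+ n) 0
      ≈⟨ ℚᵘ.+-cong (ℚ.toℚᵘ-fromℚᵘ (ℚᵘ.mkℚᵘ (+ m) 0)) (ℚ.toℚᵘ-fromℚᵘ (ℚᵘ.mkℚᵘ (+ n) 0)) ⟨
    ℚ.toℚᵘ (+ m / 1) ℚᵘ.+ ℚ.toℚᵘ (+ n / 1) ≈⟨ ℚ.toℚᵘ-homo-+ (+ m / 1) (+ n / 1) ⟨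
    ℚ.toℚᵘ (+ m / 1 + + n / 1)        ∎)
    where open SetoidReasoning ℚᵘ.≃-setoid

  fromℕ-0 : fromℕ 0 ≈⁺ 0⁺
  fromℕ-0 = ≗⇒≈⁺ {fromℕ 0} {0⁺} λ _ → refl

  fromℕ-1 : fromℕ 1 ≈⁺ 1⁺
  fromℕ-1 = ≗⇒≈⁺ {fromℕ 1} {1⁺} λ _ → refl

  fromℕ-+ : ∀ m n → fromℕ (m ℕ.+ n) ≈⁺ fromℕ m +⁺ fromℕ n
  fromℕ-+ m n = ≗⇒≈⁺ {fromℕ (m ℕ.+ n)} {fromℕ m +⁺ fromℕ n} λ _ → /1-+ m n

  fromℕ-* : ∀ m n → fromℕ (m ℕ.* n) ≈⁺ fromℕ m *⁺ fromℕ n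
  fromℕ-* m n = ≗⇒≈⁺ {fromℕ (m ℕ.* n)} {fromℕ m *⁺ fromℕ n} λ _ → sym (/-* m n 1 1)

  fraction : (m n : ℕ) .{{_ : ℕ.NonZero n}} → ℝ≥0
  fraction m n = mkℝ≥0 (fromℚ (+ m / n)) (fromℚ-nonNeg (+ m / n) {{ℚ.normalize-nonNeg m n}})

  fraction-* : ∀ m m′ n n′ k l .{{_ : ℕ.NonZero n}} .{{_ : ℕ.NonZero n′}} .{{_ : ℕ.NonZero l}} →
               k ℕ.* (n ℕ.* n′) ≡ (m ℕ.* m′) ℕ.* l →
               fraction k l ≈⁺ fraction m n *⁺ fraction m′ n′
  fraction-* m m′ n n′ k l eq = ≗⇒≈⁺ {fraction k l} {fraction m n *⁺ fraction m′ n′} λ _ →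
    trans (/-≡ k (m ℕ.* m′) l (n ℕ.* n′) eq) (sym (/-* m m′ n n′))
    where instance nn′≢0 = ℕ.m*n≢0 n n′

  √[/]-square : ∀ m n .{{_ : ℕ.NonZero n}} → √[ m / n ] *⁺ √[ m / n ] ≈⁺ fraction m n
  √[/]-square m n = √-square (+ m / n) {{ℚ.normalize-nonNeg m n}}

  -- Both sides are non-negative, so it suffices to compare their squares, which are fractions. The
  -- cross-multiplied hypothesis admits any presentation k / l of the product, reduced or not.
  √[/]-* : ∀ m m′ n n′ k l .{{_ : ℕ.NonZero n}} .{{_ : ℕ.NonZero n′}} .{{_ : ℕ.NonZero l}} →
           k ℕ.* (n ℕ.* n′) ≡ (m ℕ.* m′) ℕ.* l →
           √[ k / l ] ≈⁺ √[ m / n ] *⁺ √[ m′ / n′ ]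
  √[/]-* m m′ n n′ k l eq = square-cancel-≈ {z} {x *⁺ y} (begin
    z *⁺ z                            ≈⟨ √[/]-square k l ⟩
    fraction k l                      ≈⟨ fraction-* m m′ n n′ k l eq ⟩
    fraction m n *⁺ fraction m′ n′    ≈⟨ *-cong {x *⁺ x} {fraction m n} {y *⁺ y} {fraction m′ n′}
                                           (√[/]-square m n) (√[/]-square m′ n′) ⟨
    (x *⁺ x) *⁺ (y *⁺ y)              ≈⟨ *-interchange x x y y ⟩
    (x *⁺ y) *⁺ (x *⁺ y)              ∎)
    where
    x = √[ m / n ]
    y = √[ m′ / n′ ]
    z = √[ k / l ]
    open CommutativeSemiring ℝ≥0-commutativeSemiring using (setoid; *-cong; *-commutativeSemigroup)
    open SetoidReasoning setoid
    open CommutativeSemigroupProperties *-commutativeSemigroup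
      using () renaming (interchange to *-interchange)

  √[1/1]≈1 : √[ 1 / 1 ] ≈⁺ 1⁺
  √[1/1]≈1 = square-cancel-≈ {√[ 1 / 1 ]} {1⁺} (√[/]-square 1 1)

√[n/1]*√[1/n]≈1 : ∀ n .{{_ : ℕ.NonZero n}} → √[ n / 1 ] *⁺ √[ 1 / n ] ≈⁺ 1⁺
√[n/1]*√[1/n]≈1 n = begin
  √[ n / 1 ] *⁺ √[ 1 / n ]  ≈⟨ √[/]-* n 1 1 n 1 1 eq ⟨
  √[ 1 / 1 ]                ≈⟨ √[1/1]≈1 ⟩
  1⁺                        ∎
  where
  open SetoidReasoning (CommutativeSemiring.setoid ℝ≥0-commutativeSemiring)
  eq : 1 ℕ.* (1 ℕ.* n) ≡ n ℕ.* 1 ℕ.* 1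
  eq = ≡.trans (≡.trans (ℕ.*-identityˡ (1 ℕ.* n)) (ℕ.*-comm 1 n)) (≡.sym (ℕ.*-identityʳ (n ℕ.* 1)))

-- The equation n = 1 is a hypothesis because the valency of an identity class is 1 by proof and not
-- by computation.
√[1/n]≈1 : ∀ n .{{_ : ℕ.NonZero n}} → n ≡ 1 → √[ 1 / n ] ≈⁺ 1⁺
√[1/n]≈1 _ ≡.refl = √[1/1]≈1

√[c/ab] : ∀ a b c .{{_ : ℕ.NonZero a}} .{{_ : ℕ.NonZero b}} .{{_ : ℕ.NonZero (a ℕ.* b)}} →
          √[ c / a ℕ.* b ] ≈⁺ √[ c / 1 ] *⁺ (√[ 1 / a ] *⁺ √[ 1 / b ])
√[c/ab] a b c = begin
  √[ c / a ℕ.* b ]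
    ≈⟨ √[/]-* c 1 1 (a ℕ.* b) c (a ℕ.* b) (≡.trans (≡.cong (c ℕ.*_) (ℕ.*-identityˡ (a ℕ.* b)))
         (≡.cong (ℕ._* (a ℕ.* b)) (≡.sym (ℕ.*-identityʳ c)))) ⟩
  √[ c / 1 ] *⁺ √[ 1 / a ℕ.* b ]
    ≈⟨ *-congˡ {√[ c / 1 ]} {√[ 1 / a ℕ.* b ]} {√[ 1 / a ] *⁺ √[ 1 / b ]}
         (√[/]-* 1 1 a b 1 (a ℕ.* b) ≡.refl) ⟩
  √[ c / 1 ] *⁺ (√[ 1 / a ] *⁺ √[ 1 / b ]) ∎
  where
  open CommutativeSemiring ℝ≥0-commutativeSemiring using (setoid; *-congˡ)
  open SetoidReasoning setoid

-- Finite sums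

module FiniteSum (R : CommutativeSemiring 0ℓ 0ℓ) where
  open CommutativeSemiring R hiding (zero)
    renaming (Carrier to K; _≈_ to _≋_)
  open SemiringSum semiring public using (sum)
  open SemiringSum semiring using (sum-cong-≋; *-distribˡ-sum; *-distribʳ-sum; sum-replicate-zero)
    renaming (∑-comm to sum-comm)
  open CommutativeSemigroupProperties *-commutativeSemigroup using (x∙yz≈y∙xz; xy∙z≈y∙xz)
  open SetoidReasoning setoid

  ∑ : (X : FinSet) → (Carrier X → K) → K
  ∑ X f = sum (λ i → f (FinSet.element X i))

  infix 8 ∑-syntax
  ∑-syntax = ∑
  syntax ∑-syntax X (λ x → t) = ∑[ x ∈ X ] t

  ∑-cong : ∀ X {f g : Carrier X → K} → (∀ x → f x ≋ g x) → ∑ X f ≋ ∑ X g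
  ∑-cong X f≋g = sum-cong-≋ (λ i → f≋g (FinSet.element X i))

  ∑-comm : ∀ X Y (f : Carrier X → Carrier Y → K) →
           ∑[ x ∈ X ] ∑[ y ∈ Y ] f x y ≋ ∑[ y ∈ Y ] ∑[ x ∈ X ] f x y
  ∑-comm X Y f = sum-comm (λ i j → f (FinSet.element X i) (FinSet.element Y j))

  *-distribˡ-∑ : ∀ X k (f : Carrier X → K) → k * ∑ X f ≋ ∑[ x ∈ X ] (k * f x)
  *-distribˡ-∑ X k f = *-distribˡ-sum k (λ i → f (FinSet.element X i))

  *-distribʳ-∑ : ∀ X k (f : Carrier X → K) → ∑ X f * k ≋ ∑[ x ∈ X ] (f x * k)
  *-distribʳ-∑ X k f = *-distribʳ-sum k (λ i → f (FinSet.element X i))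

  sum-single : ∀ {n} (t : Fin n → K) i → (∀ j → j ≢ i → t j ≋ 0#) → sum t ≋ t i
  sum-single {suc n} t zero t≋0 = begin
    t zero + sum (t ∘ suc)     ≈⟨ +-congˡ (sum-cong-≋ (λ j → t≋0 (suc j) (λ ()))) ⟩
    t zero + sum {n} (λ _ → 0#) ≈⟨ +-congˡ (sum-replicate-zero n) ⟩
    t zero + 0#                ≈⟨ +-identityʳ (t zero) ⟩
    t zero                     ∎
  sum-single {suc n} t (suc i) t≋0 = begin
    t zero + sum (t ∘ suc)
      ≈⟨ +-cong (t≋0 zero (λ ())) (sum-single (t ∘ suc) i (λ j j≢i → t≋0 (suc j) (j≢i ∘ Fin.suc-injective))) ⟩
    0# + t (suc i)             ≈⟨ +-identityˡ (t (suc i)) ⟩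
    t (suc i)                  ∎

  ∑-single : ∀ X (f : Carrier X → K) x → (∀ y → y ≢ x → f y ≋ 0#) → ∑ X f ≋ f x
  ∑-single X f x f≋0 = begin
    ∑ X f          ≈⟨ sum-single (f ∘ to) (from x) (λ j j≢ → f≋0 (to j)
                        (λ eq → j≢ (≡.trans (≡.sym (strictlyInverseʳ j)) (≡.cong from eq)))) ⟩
    f (to (from x)) ≡⟨ ≡.cong f (strictlyInverseˡ x) ⟩
    f x            ∎
    where open Inverse (FinSet.enum X) using (to; from; strictlyInverseˡ; strictlyInverseʳ)

  sum-+ : ∀ m {n} (t : Fin (m ℕ.+ n) → K) →
          sum t ≋ sum (λ i → t (i Fin.↑ˡ n)) + sum (λ j → t (m Fin.↑ʳ j))
  sum-+ zero    t = sym (+-identityˡ (sum t))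
  sum-+ (suc m) t = trans (+-congˡ (sum-+ m (t ∘ suc))) (sym (+-assoc _ _ _))

  sum-combine : ∀ m n (t : Fin (m ℕ.* n) → K) →
                sum t ≋ sum (λ i → sum (λ j → t (Fin.combine {m} {n} i j)))
  sum-combine zero    n t = refl
  sum-combine (suc m) n t =
    trans (sum-+ n t) (+-congˡ (sum-combine m n (λ k → t (n Fin.↑ʳ k))))

  ∑-⊗ : ∀ X Y (f : Carrier X × Carrier Y → K) →
        ∑ (X ⊗₀ Y) f ≋ ∑[ x ∈ X ] ∑[ y ∈ Y ] f (x , y)
  ∑-⊗ X Y f = trans (sum-combine m n (f ∘ FinSet.element (X ⊗₀ Y)))
    -- The enumeration of a product set decodes an index by `remQuot`, which undoes `combine`.
    (sum-cong-≋ λ i → sum-cong-≋ λ j → reflexive (≡.cong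
      (λ k → f (FinSet.element X (proj₁ k) , FinSet.element Y (proj₂ k)))
      (Fin.remQuot-combine {m} {n} i j)))
    where
    m = FinSet.size X
    n = FinSet.size Y

  -- Indicators and Kronecker deltas

  𝟙 : ∀ {P : Set} → Dec P → K
  𝟙 P? = if does P? then 1# else 0#

  𝟙-true : ∀ {P} (P? : Dec P) → P → 𝟙 P? ≋ 1#
  𝟙-true (yes _) _ = refl
  𝟙-true (no ¬p) p = ⊥-elim (¬p p)

  𝟙-false : ∀ {P} (P? : Dec P) → ¬ P → 𝟙 P? ≋ 0#
  𝟙-false (yes p) ¬p = ⊥-elim (¬p p)
  𝟙-false (no _)  _  = refl

  𝟙-× : ∀ {P Q} (P? : Dec P) (Q? : Dec Q) → 𝟙 (P? ×-dec Q?) ≋ 𝟙 P? * 𝟙 Q?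
  𝟙-× (yes _) (yes _) = sym (*-identityˡ 1#)
  𝟙-× (yes _) (no _)  = sym (*-identityˡ 0#)
  𝟙-× (no _)  Q?      = sym (zeroˡ (𝟙 Q?))

  𝟙-cong : ∀ {P Q} (P? : Dec P) (Q? : Dec Q) → (P → Q) → (Q → P) → 𝟙 P? ≋ 𝟙 Q?
  𝟙-cong (yes p) Q? P⇒Q Q⇒P = sym (𝟙-true Q? (P⇒Q p))
  𝟙-cong (no ¬p) Q? P⇒Q Q⇒P = sym (𝟙-false Q? (¬p ∘ Q⇒P))

  𝟙-*-cong : ∀ {P k l} (P? : Dec P) → (P → k ≋ l) → 𝟙 P? * k ≋ 𝟙 P? * l
  𝟙-*-cong         (yes p) k≋l = *-congˡ (k≋l p)
  𝟙-*-cong {k = k} {l} (no _) _ = trans (zeroˡ k) (sym (zeroˡ l))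

  -- A Kronecker delta up to the equality of the semiring. It is a property of functions so that it
  -- covers both the indicator of the classes containing a given pair and the rows and columns of
  -- matrices of functions.
  Delta : (X : FinSet) → Carrier X → (Carrier X → K) → Set
  Delta X x δ = δ x ≋ 1# × (∀ y → y ≢ x → δ y ≋ 0#)

  𝟙-delta : ∀ X {P : Carrier X → Set} (P? : ∀ x → Dec (P x)) x →
            P x → (∀ y → P y → y ≡ x) → Delta X x (λ y → 𝟙 (P? y))
  𝟙-delta X P? x px unique =
    𝟙-true (P? x) px , λ y y≢x → 𝟙-false (P? y) (y≢x ∘ unique y)

  ∑-delta : ∀ X x δ → Delta X x δ → (f : Carrier X → K) → ∑[ y ∈ X ] (δ y * f y) ≋ f x
  ∑-delta X x δ (δ≋1 , δ≋0) f = begin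
    ∑[ y ∈ X ] (δ y * f y)
      ≈⟨ ∑-single X (λ y → δ y * f y) x (λ y y≢x → trans (*-congʳ (δ≋0 y y≢x)) (zeroˡ (f y))) ⟩
    δ x * f x       ≈⟨ *-congʳ δ≋1 ⟩
    1# * f x        ≈⟨ *-identityˡ (f x) ⟩
    f x             ∎

  -- `h` is given apart from its factorisation because it may be an entry of a composite matrix,
  -- which becomes a product only after another delta has been summed out.
  ∑-⊗-deltaʳ : ∀ X Y y δ → Delta Y y δ → (f : Carrier X → K) (g h : Carrier X × Carrier Y → K) →
               (∀ x y → h (x , y) ≋ f x * δ y) →
               ∑[ u ∈ X ⊗₀ Y ] (h u * g u) ≋ ∑[ x ∈ X ] (f x * g (x , y))
  ∑-⊗-deltaʳ X Y y δ δ-delta f g h h≋ = begin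
    ∑[ u ∈ X ⊗₀ Y ] (h u * g u)
      ≈⟨ ∑-⊗ X Y (λ u → h u * g u) ⟩
    ∑[ x ∈ X ] ∑[ y ∈ Y ] (h (x , y) * g (x , y))
      ≈⟨ ∑-cong X (λ x → ∑-cong Y (λ y →
           trans (*-congʳ (h≋ x y)) (xy∙z≈y∙xz (f x) (δ y) (g (x , y))))) ⟩
    ∑[ x ∈ X ] ∑[ y ∈ Y ] (δ y * (f x * g (x , y)))
      ≈⟨ ∑-cong X (λ x → ∑-delta Y y δ δ-delta (λ y → f x * g (x , y))) ⟩
    ∑[ x ∈ X ] (f x * g (x , y)) ∎

  ∑-⊗-deltaˡ : ∀ X Y x δ → Delta X x δ → (f : Carrier Y → K) (g h : Carrier X × Carrier Y → K) →
               (∀ x y → h (x , y) ≋ δ x * f y) →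
               ∑[ u ∈ X ⊗₀ Y ] (h u * g u) ≋ ∑[ y ∈ Y ] (f y * g (x , y))
  ∑-⊗-deltaˡ X Y x δ δ-delta f g h h≋ = begin
    ∑[ u ∈ X ⊗₀ Y ] (h u * g u)
      ≈⟨ ∑-⊗ X Y (λ u → h u * g u) ⟩
    ∑[ x ∈ X ] ∑[ y ∈ Y ] (h (x , y) * g (x , y))
      ≈⟨ ∑-cong X (λ x → ∑-cong Y (λ y →
           trans (*-congʳ (h≋ x y)) (*-assoc (δ x) (f y) (g (x , y))))) ⟩
    ∑[ x ∈ X ] ∑[ y ∈ Y ] (δ x * (f y * g (x , y)))
      ≈⟨ ∑-cong X (λ x → *-distribˡ-∑ Y (δ x) (λ y → f y * g (x , y))) ⟨
    ∑[ x ∈ X ] (δ x * ∑[ y ∈ Y ] (f y * g (x , y)))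
      ≈⟨ ∑-delta X x δ δ-delta (λ x → ∑[ y ∈ Y ] (f y * g (x , y))) ⟩
    ∑[ y ∈ Y ] (f y * g (x , y)) ∎

  ∑-*-comm : ∀ X (f g : Carrier X → K) → ∑[ x ∈ X ] (f x * g x) ≋ ∑[ x ∈ X ] (g x * f x)
  ∑-*-comm X f g = ∑-cong X (λ x → *-comm (f x) (g x))

  ∑-*-cong : ∀ X (f f′ g g′ : Carrier X → K) → (∀ x → f x ≋ f′ x) → (∀ x → g x ≋ g′ x) →
             ∑[ x ∈ X ] (f x * g x) ≋ ∑[ x ∈ X ] (f′ x * g′ x)
  ∑-*-cong X f f′ g g′ f≋ g≋ = ∑-cong X (λ x → *-cong (f≋ x) (g≋ x))

  -- For a row vector f, a matrix g and a column vector h this is f(gh) = (fg)h.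
  ∑-assoc : ∀ X Y (f : Carrier X → K) (g : Carrier X → Carrier Y → K) (h : Carrier Y → K) →
            ∑[ x ∈ X ] (f x * ∑[ y ∈ Y ] (g x y * h y)) ≋
            ∑[ y ∈ Y ] (∑[ x ∈ X ] (f x * g x y) * h y)
  ∑-assoc X Y f g h = begin
    ∑[ x ∈ X ] (f x * ∑[ y ∈ Y ] (g x y * h y))
      ≈⟨ ∑-cong X (λ x → trans (*-distribˡ-∑ Y (f x) (λ y → g x y * h y))
           (∑-cong Y (λ y → sym (*-assoc (f x) (g x y) (h y))))) ⟩
    ∑[ x ∈ X ] ∑[ y ∈ Y ] (f x * g x y * h y)
      ≈⟨ ∑-comm X Y (λ x y → f x * g x y * h y) ⟩
    ∑[ y ∈ Y ] ∑[ x ∈ X ] (f x * g x y * h y)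
      ≈⟨ ∑-cong Y (λ y → *-distribʳ-∑ X (h y) (λ x → f x * g x y)) ⟨
    ∑[ y ∈ Y ] (∑[ x ∈ X ] (f x * g x y) * h y) ∎

  ∑-swap : ∀ X Y (f : Carrier X → K) (g : Carrier Y → K) (h : Carrier X → Carrier Y → K) →
           ∑[ x ∈ X ] (f x * ∑[ y ∈ Y ] (g y * h x y)) ≋
           ∑[ y ∈ Y ] (g y * ∑[ x ∈ X ] (f x * h x y))
  ∑-swap X Y f g h = begin
    ∑[ x ∈ X ] (f x * ∑[ y ∈ Y ] (g y * h x y))
      ≈⟨ ∑-cong X (λ x → *-distribˡ-∑ Y (f x) (λ y → g y * h x y)) ⟩
    ∑[ x ∈ X ] ∑[ y ∈ Y ] (f x * (g y * h x y))
      ≈⟨ ∑-comm X Y (λ x y → f x * (g y * h x y)) ⟩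
    ∑[ y ∈ Y ] ∑[ x ∈ X ] (f x * (g y * h x y))
      ≈⟨ ∑-cong Y (λ y → ∑-cong X (λ x → x∙yz≈y∙xz (f x) (g y) (h x y))) ⟩
    ∑[ y ∈ Y ] ∑[ x ∈ X ] (g y * (f x * h x y))
      ≈⟨ ∑-cong Y (λ y → *-distribˡ-∑ X (g y) (λ x → f x * h x y)) ⟨
    ∑[ y ∈ Y ] (g y * ∑[ x ∈ X ] (f x * h x y)) ∎

-- Structure constants of a coherent configuration

module Counting (C : CoherentConfiguration) where
  open CoherentConfiguration C
  open FiniteSum ℕ.+-*-commutativeSemiring
  open import Data.Nat.Base using (_*_)
  open ≡-Reasoning

  -- The adjacency matrix of the class `a`; path counts are then entries of matrix products.
  χ : Carrier S → Carrier X × Carrier X → ℕ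
  χ a p = 𝟙 (a ∋? p)

  class : Carrier X × Carrier X → Carrier S
  class p = proj₁ (covers p)

  class-∋ : ∀ p → class p ∋ p
  class-∋ p = proj₁ (proj₂ (covers p))

  class-unique : ∀ p a → a ∋ p → a ≡ class p
  class-unique p a a∋p = ≡.sym (proj₂ (proj₂ (covers p)) a∋p)

  source target : Carrier S → Carrier X
  source a = proj₁ (proj₁ (nonempty a))
  target a = proj₂ (proj₁ (nonempty a))

  ∋-source-target : ∀ a → a ∋ (source a , target a)
  ∋-source-target a = proj₂ (nonempty a)

  infix 30 _⁻¹
  _⁻¹ : Carrier S → Carrier S
  a ⁻¹ = proj₁ (converse a)

  χ-⁻¹ : ∀ a x y → χ (a ⁻¹) (y , x) ≡ χ a (x , y)
  χ-⁻¹ a x y = 𝟙-cong (a ⁻¹ ∋? (y , x)) (a ∋? (x , y)) to from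
    where open Equivalence (proj₂ (converse a) x y) using (to; from)

  paths≡∑χ : ∀ a b x y → paths a b (x , y) ≡ ∑[ z ∈ X ] (χ a (x , z) * χ b (z , y))
  paths≡∑χ a b x y = ∑-cong X (λ z → 𝟙-× (a ∋? (x , z)) (b ∋? (z , y)))

  ∇≡paths : ∀ a b {c p} → c ∋ p → ∇ a b c ≡ paths a b p
  ∇≡paths a b {c} = coherent a b c (∋-source-target c)

  ∑-χ : ∀ (f : Carrier S → ℕ) p → ∑[ t ∈ S ] (χ t p * f t) ≡ f (class p)
  ∑-χ f p = ∑-delta S (class p) (λ t → χ t p) (𝟙-delta S (_∋? p) (class p) (class-∋ p) (class-unique p)) f

  -- With adjacency matrices A this says that the product of A_a and A_b is the combination of the
  -- A_t with coefficients `∇ a b t`. At p only the class of p contributes, and coherence identifies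
  -- its coefficient.
  ∑-∇-χ : ∀ a b p → ∑[ t ∈ S ] (∇ a b t * χ t p) ≡ paths a b p
  ∑-∇-χ a b p = begin
    ∑[ t ∈ S ] (∇ a b t * χ t p)  ≡⟨ ∑-cong S (λ t → ℕ.*-comm (∇ a b t) (χ t p)) ⟩
    ∑[ t ∈ S ] (χ t p * ∇ a b t)  ≡⟨ ∑-χ (∇ a b) p ⟩
    ∇ a b (class p)               ≡⟨ ∇≡paths a b (class-∋ p) ⟩
    paths a b p                   ∎

  -- The expansion of a product of two adjacency matrices is multiplied by a third one on the right;
  -- `∑-∇-pathsʳ` multiplies it on the left.
  ∑-∇-pathsˡ : ∀ a b c x y → ∑[ t ∈ S ] (∇ a b t * paths t c (x , y)) ≡
                             ∑[ z ∈ X ] (paths a b (x , z) * χ c (z , y))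
  ∑-∇-pathsˡ a b c x y = begin
    ∑[ t ∈ S ] (∇ a b t * paths t c (x , y))
      ≡⟨ ∑-cong S (λ t → ≡.cong (∇ a b t *_) (paths≡∑χ t c x y)) ⟩
    ∑[ t ∈ S ] (∇ a b t * ∑[ z ∈ X ] (χ t (x , z) * χ c (z , y)))
      ≡⟨ ∑-assoc S X (∇ a b) (λ t z → χ t (x , z)) (λ z → χ c (z , y)) ⟩
    ∑[ z ∈ X ] (∑[ t ∈ S ] (∇ a b t * χ t (x , z)) * χ c (z , y))
      ≡⟨ ∑-cong X (λ z → ≡.cong (_* χ c (z , y)) (∑-∇-χ a b (x , z))) ⟩
    ∑[ z ∈ X ] (paths a b (x , z) * χ c (z , y)) ∎

  ∑-∇-pathsʳ : ∀ a b c x y → ∑[ t ∈ S ] (∇ b c t * paths a t (x , y)) ≡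
                             ∑[ z ∈ X ] (χ a (x , z) * paths b c (z , y))
  ∑-∇-pathsʳ a b c x y = begin
    ∑[ t ∈ S ] (∇ b c t * paths a t (x , y))
      ≡⟨ ∑-cong S (λ t → ≡.cong (∇ b c t *_) (paths≡∑χ a t x y)) ⟩
    ∑[ t ∈ S ] (∇ b c t * ∑[ z ∈ X ] (χ a (x , z) * χ t (z , y)))
      ≡⟨ ∑-swap S X (∇ b c) (λ z → χ a (x , z)) (λ t z → χ t (z , y)) ⟩
    ∑[ z ∈ X ] (χ a (x , z) * ∑[ t ∈ S ] (∇ b c t * χ t (z , y)))
      ≡⟨ ∑-cong X (λ z → ≡.cong (χ a (x , z) *_) (∑-∇-χ b c (z , y))) ⟩
    ∑[ z ∈ X ] (χ a (x , z) * paths b c (z , y)) ∎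

  ∇-assoc : ∀ a b c d → ∑[ t ∈ S ] (∇ a b t * ∇ t c d) ≡ ∑[ t ∈ S ] (∇ b c t * ∇ a t d)
  ∇-assoc a b c d = begin
    -- `∇ t c d` is by definition the path count at the chosen pair (x, y) of d.
    ∑[ t ∈ S ] (∇ a b t * paths t c (x , y))
      ≡⟨ ∑-∇-pathsˡ a b c x y ⟩
    ∑[ z ∈ X ] (paths a b (x , z) * χ c (z , y))
      ≡⟨ ∑-cong X (λ z → ≡.cong (_* χ c (z , y)) (paths≡∑χ a b x z)) ⟩
    ∑[ z ∈ X ] (∑[ w ∈ X ] (χ a (x , w) * χ b (w , z)) * χ c (z , y))
      ≡⟨ ∑-assoc X X (λ w → χ a (x , w)) (λ w z → χ b (w , z)) (λ z → χ c (z , y)) ⟨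
    ∑[ w ∈ X ] (χ a (x , w) * ∑[ z ∈ X ] (χ b (w , z) * χ c (z , y)))
      ≡⟨ ∑-cong X (λ w → ≡.cong (χ a (x , w) *_) (paths≡∑χ b c w y)) ⟨
    ∑[ w ∈ X ] (χ a (x , w) * paths b c (w , y))
      ≡⟨ ∑-∇-pathsʳ a b c x y ⟨
    ∑[ t ∈ S ] (∇ b c t * paths a t (x , y)) ∎
    where
    x = source d
    y = target d

  -- Degrees of points and valencies of classes

  degree : Carrier S → Carrier X → ℕ
  degree a x = ∑[ y ∈ X ] χ a (x , y)

  -- A finite search turns a non-vanishing structure constant into an actual intermediate point.
  count-witness : ∀ Y {P : Carrier Y → Set} (P? : ∀ y → Dec (P y)) →
                  ℕ.NonZero (count Y P?) → ∃[ y ] P y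
  count-witness Y {P} P? = search (FinSet.size Y) (FinSet.element Y)
    where
    search : ∀ n (f : Fin n → Carrier Y) → ℕ.NonZero (sum (λ i → 𝟙 (P? (f i)))) → ∃[ y ] P y
    search (suc n) f nz with P? (f zero)
    ... | yes p = f zero , p
    ... | no _  = search n (f ∘ suc) nz

  -- A path x → y → x along c and back is determined by its middle point. As a path count at the
  -- loop (x, x), the degree falls under coherence.
  degree≡paths : ∀ c x → degree c x ≡ paths c (c ⁻¹) (x , x)
  degree≡paths c x = ∑-cong X λ y → 𝟙-cong (c ∋? (x , y)) ((c ∋? (x , y)) ×-dec (c ⁻¹ ∋? (y , x)))
    (λ c∋xy → c∋xy , Equivalence.from (proj₂ (converse c) x y) c∋xy) proj₁

  -- Let i be the class of (x′, x′). The pair (x′, u′) factors through i and then a with middle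
  -- point x′, so by coherence (x, u) also factors through i and then a. Since i lies in the
  -- diagonal, the middle point is x itself.
  source-loop : ∀ {a x x′ u u′} → a ∋ (x , u) → a ∋ (x′ , u′) → class (x′ , x′) ∋ (x , x)
  source-loop {a} {x} {x′} {u} {u′} a∋xu a∋x′u′ =
    let i = class (x′ , x′)
        i∋x′x′ = class-∋ (x′ , x′)
        z , i∋xz , a∋zu = count-witness X (λ z → (i ∋? (x , z)) ×-dec (a ∋? (z , u)))
          (≡.subst ℕ.NonZero (coherent i a a a∋x′u′ a∋xu)
            (count-nonZero X (λ z → (i ∋? (x′ , z)) ×-dec (a ∋? (z , u′))) x′ (i∋x′x′ , a∋x′u′)))
    in ≡.subst (λ z → i ∋ (x , z)) (≡.sym (diagonal i x′ i∋x′x′ i∋xz)) i∋xz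

  degree-source : ∀ c {a x x′ u u′} → a ∋ (x , u) → a ∋ (x′ , u′) → degree c x ≡ degree c x′
  degree-source c {a} {x} {x′} a∋xu a∋x′u′ = begin
    degree c x                  ≡⟨ degree≡paths c x ⟩
    paths c (c ⁻¹) (x , x)      ≡⟨ coherent c (c ⁻¹) (class (x′ , x′)) (source-loop a∋xu a∋x′u′) (class-∋ (x′ , x′)) ⟩
    paths c (c ⁻¹) (x′ , x′)    ≡⟨ degree≡paths c x′ ⟨
    degree c x′                 ∎

  -- A point with no c-successor has degree 0, so the factor `∇ a b c` is essential: if it vanishes
  -- both sides are 0, and otherwise the chosen source of c also starts a pair of a, and the degree
  -- in c is constant on the sources of a.
  ‖‖-∇ : ∀ a b c {x u} → a ∋ (x , u) → ‖ c ‖ * ∇ a b c ≡ degree c x * ∇ a b c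
  ‖‖-∇ a b c {x} a∋xu = go (∇ a b c) ≡.refl
    where
    go : ∀ n → ∇ a b c ≡ n → ‖ c ‖ * n ≡ degree c x * n
    go zero    _  = ≡.trans (ℕ.*-zeroʳ ‖ c ‖) (≡.sym (ℕ.*-zeroʳ (degree c x)))
    go (suc n) eq =
      let z , a∋ , _ = count-witness X (λ z → (a ∋? (source c , z)) ×-dec (b ∋? (z , target c)))
                         (≡.subst ℕ.NonZero (≡.sym eq) _)
      in ≡.cong (_* suc n) (degree-source c a∋ a∋xu)

  -- At each c-successor y of x coherence equates `∇ a b c` with the path count; at every other y
  -- the indicator annihilates both terms.
  degree-∇ : ∀ a b c x → degree c x * ∇ a b c ≡ ∑[ y ∈ X ] (χ c (x , y) * paths a b (x , y))
  degree-∇ a b c x = ≡.trans (*-distribʳ-∑ X (∇ a b c) (λ y → χ c (x , y)))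
    (∑-cong X (λ y → 𝟙-*-cong (c ∋? (x , y)) (∇≡paths a b)))

  -- Both sides count the pairs v, y with x → v in b, v → y in c and u → y in a. Reversing v → y
  -- turns the last two edges into a path u → y → v.
  ∑-χ-paths : ∀ a b c x u → ∑[ y ∈ X ] (χ a (u , y) * paths b c (x , y)) ≡
                            ∑[ v ∈ X ] (χ b (x , v) * paths a (c ⁻¹) (u , v))
  ∑-χ-paths a b c x u = begin
    ∑[ y ∈ X ] (χ a (u , y) * paths b c (x , y))
      ≡⟨ ∑-cong X (λ y → ≡.cong (χ a (u , y) *_) (paths≡∑χ b c x y)) ⟩
    ∑[ y ∈ X ] (χ a (u , y) * ∑[ v ∈ X ] (χ b (x , v) * χ c (v , y)))
      ≡⟨ ∑-swap X X (λ y → χ a (u , y)) (λ v → χ b (x , v)) (λ y v → χ c (v , y)) ⟩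
    ∑[ v ∈ X ] (χ b (x , v) * ∑[ y ∈ X ] (χ a (u , y) * χ c (v , y)))
      ≡⟨ ∑-cong X (λ v → ≡.cong (χ b (x , v) *_) (≡.trans
           (∑-cong X (λ y → ≡.cong (χ a (u , y) *_) (≡.sym (χ-⁻¹ c v y))))
           (≡.sym (paths≡∑χ a (c ⁻¹) u v)))) ⟩
    ∑[ v ∈ X ] (χ b (x , v) * paths a (c ⁻¹) (u , v)) ∎

  -- Both sides count the triangles formed by x → v in t, v → y in d and x → y in b at one source x
  -- of b, sorted by y on the left and by v on the right.
  ∇-rotate : ∀ t d b → ‖ b ‖ * ∇ t d b ≡ ‖ t ‖ * ∇ b (d ⁻¹) t
  ∇-rotate t d b = begin
    -- `‖ b ‖` is by definition the degree of b at its chosen source.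
    ‖ b ‖ * ∇ t d b                                       ≡⟨ degree-∇ t d b x ⟩
    ∑[ y ∈ X ] (χ b (x , y) * paths t d (x , y))          ≡⟨ ∑-χ-paths b t d x x ⟩
    ∑[ v ∈ X ] (χ t (x , v) * paths b (d ⁻¹) (x , v))     ≡⟨ degree-∇ b (d ⁻¹) t x ⟨
    degree t x * ∇ b (d ⁻¹) t                             ≡⟨ ‖‖-∇ b (d ⁻¹) t (∋-source-target b) ⟨
    ‖ t ‖ * ∇ b (d ⁻¹) t                                  ∎
    where x = source b

  -- Each side carries a structure constant with first argument `a`, so at a source x of `a` the
  -- valencies can be exchanged for degrees by `‖‖-∇`.
  ∇-frobenius : ∀ a b c d → ∑[ t ∈ S ] (‖ t ‖ * ∇ a b t * ∇ c d t) ≡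
                            ∑[ t ∈ S ] (‖ c ‖ * ∇ a t c * ∇ b (d ⁻¹) t)
  ∇-frobenius a b c d = begin
    ∑[ t ∈ S ] (‖ t ‖ * ∇ a b t * ∇ c d t)
      ≡⟨ ∑-cong S (λ t → begin
           ‖ t ‖ * ∇ a b t * ∇ c d t
             ≡⟨ ≡.cong (_* ∇ c d t) (‖‖-∇ a b t a∋) ⟩
           degree t x * ∇ a b t * ∇ c d t
             ≡⟨ ℕ.*-assoc (degree t x) (∇ a b t) (∇ c d t) ⟩
           degree t x * (∇ a b t * ∇ c d t)
             ≡⟨ *-distribʳ-∑ X (∇ a b t * ∇ c d t) (λ y → χ t (x , y)) ⟩
           ∑[ y ∈ X ] (χ t (x , y) * (∇ a b t * ∇ c d t)) ∎) ⟩
    ∑[ t ∈ S ] ∑[ y ∈ X ] (χ t (x , y) * (∇ a b t * ∇ c d t))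
      ≡⟨ ∑-comm S X (λ t y → χ t (x , y) * (∇ a b t * ∇ c d t)) ⟩
    ∑[ y ∈ X ] ∑[ t ∈ S ] (χ t (x , y) * (∇ a b t * ∇ c d t))
      -- Exactly one class contains (x, y), so the sum over t collapses.
      ≡⟨ ∑-cong X (λ y → ≡.trans (∑-χ (λ t → ∇ a b t * ∇ c d t) (x , y))
           (≡.cong₂ _*_ (∇≡paths a b (class-∋ (x , y))) (∇≡paths c d (class-∋ (x , y))))) ⟩
    ∑[ y ∈ X ] (paths a b (x , y) * paths c d (x , y))
      ≡⟨ ∑-cong X (λ y → ≡.cong (_* paths c d (x , y)) (paths≡∑χ a b x y)) ⟩
    ∑[ y ∈ X ] (∑[ u ∈ X ] (χ a (x , u) * χ b (u , y)) * paths c d (x , y))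
      ≡⟨ ∑-assoc X X (λ u → χ a (x , u)) (λ u y → χ b (u , y)) (λ y → paths c d (x , y)) ⟨
    ∑[ u ∈ X ] (χ a (x , u) * ∑[ y ∈ X ] (χ b (u , y) * paths c d (x , y)))
      -- The corner y is absorbed: the edges u → y and v → y become a path from u to v.
      ≡⟨ ∑-cong X (λ u → ≡.cong (χ a (x , u) *_) (∑-χ-paths b c d x u)) ⟩
    ∑[ u ∈ X ] (χ a (x , u) * ∑[ v ∈ X ] (χ c (x , v) * paths b (d ⁻¹) (u , v)))
      ≡⟨ ∑-swap X X (λ u → χ a (x , u)) (λ v → χ c (x , v)) (λ u v → paths b (d ⁻¹) (u , v)) ⟩
    ∑[ v ∈ X ] (χ c (x , v) * ∑[ u ∈ X ] (χ a (x , u) * paths b (d ⁻¹) (u , v)))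
      -- A sum over t returns, with t now the class of (u, v).
      ≡⟨ ∑-cong X (λ v → ≡.cong (χ c (x , v) *_) (∑-∇-pathsʳ a b (d ⁻¹) x v)) ⟨
    ∑[ v ∈ X ] (χ c (x , v) * ∑[ t ∈ S ] (∇ b (d ⁻¹) t * paths a t (x , v)))
      ≡⟨ ∑-swap X S (λ v → χ c (x , v)) (∇ b (d ⁻¹)) (λ v t → paths a t (x , v)) ⟩
    ∑[ t ∈ S ] (∇ b (d ⁻¹) t * ∑[ v ∈ X ] (χ c (x , v) * paths a t (x , v)))
      ≡⟨ ∑-cong S (λ t → begin
           ∇ b (d ⁻¹) t * ∑[ v ∈ X ] (χ c (x , v) * paths a t (x , v))
             ≡⟨ ≡.cong (∇ b (d ⁻¹) t *_) (degree-∇ a t c x) ⟨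
           ∇ b (d ⁻¹) t * (degree c x * ∇ a t c)
             ≡⟨ ≡.cong (∇ b (d ⁻¹) t *_) (‖‖-∇ a t c a∋) ⟨
           ∇ b (d ⁻¹) t * (‖ c ‖ * ∇ a t c)
             ≡⟨ ℕ.*-comm (∇ b (d ⁻¹) t) (‖ c ‖ * ∇ a t c) ⟩
           ‖ c ‖ * ∇ a t c * ∇ b (d ⁻¹) t ∎) ⟩
    ∑[ t ∈ S ] (‖ c ‖ * ∇ a t c * ∇ b (d ⁻¹) t) ∎
    where
    x  = source a
    a∋ = ∋-source-target a

  -- Classes contained in the diagonal

  ⊆id : Carrier S → Set
  ⊆id a = ∀ x y → a ∋ (x , y) → x ≡ y

  ⊆id-class : ∀ x → ⊆id (class (x , x))
  ⊆id-class x _ _ = diagonal (class (x , x)) x (class-∋ (x , x))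

  ‖‖-⊆id : ∀ {a} → ⊆id a → ‖ a ‖ ≡ 1
  ‖‖-⊆id {a} a⊆id = begin
    degree a (source a)        ≡⟨ ∑-single X (λ y → χ a (source a , y)) (source a)
                                    (λ y y≢ → 𝟙-false (a ∋? (source a , y)) (λ a∋ → y≢ (≡.sym (a⊆id _ _ a∋)))) ⟩
    χ a (source a , source a)  ≡⟨ 𝟙-true (a ∋? (source a , source a))
                                    (≡.subst (λ y → a ∋ (source a , y)) (≡.sym (a⊆id _ _ (∋-source-target a))) (∋-source-target a)) ⟩
    1                          ∎

  -- A path whose first step lies in the diagonal can only have its starting point as middle point.
  ∇-⊆idˡ : ∀ {i} b c → ⊆id i → ∇ i b c ≡ χ i (source c , source c) * χ b (source c , target c)
  ∇-⊆idˡ {i} b c i⊆id = ≡.trans (paths≡∑χ i b x y)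
    (∑-single X (λ z → χ i (x , z) * χ b (z , y)) x
      (λ z z≢x → ≡.cong (_* χ b (z , y)) (𝟙-false (i ∋? (x , z)) (λ i∋ → z≢x (≡.sym (i⊆id _ _ i∋))))))
    where
    x = source c
    y = target c

  -- The loop factor comes first, as in `∇-⊆idˡ`, so that `χ-loop` serves both unit laws.
  ∇-⊆idʳ : ∀ {i} b c → ⊆id i → ∇ b i c ≡ χ i (target c , target c) * χ b (source c , target c)
  ∇-⊆idʳ {i} b c i⊆id = ≡.trans (paths≡∑χ b i x y) (≡.trans
    (∑-single X (λ z → χ b (x , z) * χ i (z , y)) y
      (λ z z≢y → ≡.trans (≡.cong (χ b (x , z) *_) (𝟙-false (i ∋? (z , y)) (λ i∋ → z≢y (i⊆id _ _ i∋))))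
        (ℕ.*-zeroʳ (χ b (x , z)))))
    (ℕ.*-comm (χ b (x , y)) (χ i (y , y))))
    where
    x = source c
    y = target c

-- Normalised structure constants over a commutative semiring

module Weighted (R : CommutativeSemiring 0ℓ 0ℓ) (C : CoherentConfiguration) where
  open CommutativeSemiring R hiding (zero) renaming (Carrier to K; _≈_ to _≋_)
  open CoherentConfiguration C
  open FiniteSum R
  open Counting C
  open SetoidReasoning setoid
  open CommutativeMonoidSolver *-commutativeMonoid using (solve; _⊕_; _⊜_)
  private module ℕ-Sum = FiniteSum ℕ.+-*-commutativeSemiring

  -- Square roots enter only through the listed relations for `s` and `r`; `ι` embeds the counts,
  -- `M` is the normalised multiplication and `ε` the unit. The relations s a · s a = ι ‖ a ‖ and s
  -- a · r a = 1 leave a sign open in a general semiring, whence the separate hypothesis at valency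
  -- 1.
  module Normalised
    (ι : ℕ → K) (ι-0 : ι 0 ≋ 0#) (ι-1 : ι 1 ≋ 1#)
    (ι-+ : ∀ m n → ι (m ℕ.+ n) ≋ ι m + ι n) (ι-* : ∀ m n → ι (m ℕ.* n) ≋ ι m * ι n)
    (s r : Carrier S → K) (s*s : ∀ a → s a * s a ≋ ι ‖ a ‖) (s*r : ∀ a → s a * r a ≋ 1#)
    (‖‖≡1⇒r≋1 : ∀ a → ‖ a ‖ ≡ 1 → r a ≋ 1#)
    (M : Carrier S → Carrier S → Carrier S → K)
    (M-def : ∀ a b c → M a b c ≋ s c * (r a * r b) * ι (∇ a b c))
    (ε : Carrier S → K) (ε≋1 : ∀ i → ⊆id i → ε i ≋ 1#) (ε≋0 : ∀ i → ¬ ⊆id i → ε i ≋ 0#)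
    where

    ι-∑ : ∀ X (f : Carrier X → ℕ) → ι (ℕ-Sum.∑ X f) ≋ ∑[ x ∈ X ] ι (f x)
    ι-∑ X f = go (FinSet.size X) (λ i → f (FinSet.element X i))
      where
      go : ∀ n (t : Fin n → ℕ) → ι (ℕ-Sum.sum t) ≋ sum (λ i → ι (t i))
      go zero    t = ι-0
      go (suc n) t = trans (ι-+ (t zero) (ℕ-Sum.sum (t ∘ suc))) (+-congˡ (go n (t ∘ suc)))

    *-ι-∑ : ∀ X k {f : Carrier X → K} (g : Carrier X → ℕ) → (∀ x → f x ≋ k * ι (g x)) →
            ∑ X f ≋ k * ι (ℕ-Sum.∑ X g)
    *-ι-∑ X k {f} g f≋ = begin
      ∑ X f                       ≈⟨ ∑-cong X f≋ ⟩
      ∑[ x ∈ X ] (k * ι (g x))    ≈⟨ *-distribˡ-∑ X k (ι ∘ g) ⟨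
      k * ∑[ x ∈ X ] ι (g x)      ≈⟨ *-congˡ (ι-∑ X g) ⟨
      k * ι (ℕ-Sum.∑ X g)         ∎

    s*r-cancel : ∀ t k m n → s t * r t * (k * (ι m * ι n)) ≋ k * ι (m ℕ.* n)
    s*r-cancel t k m n = begin
      s t * r t * (k * (ι m * ι n))  ≈⟨ *-congʳ (s*r t) ⟩
      1# * (k * (ι m * ι n))         ≈⟨ *-identityˡ (k * (ι m * ι n)) ⟩
      k * (ι m * ι n)                ≈⟨ *-congˡ (ι-* m n) ⟨
      k * ι (m ℕ.* n)                ∎

    M-assoc : ∀ a b c d → ∑[ t ∈ S ] (M a b t * M t c d) ≋ ∑[ t ∈ S ] (M b c t * M a t d)
    M-assoc a b c d = begin
      ∑[ t ∈ S ] (M a b t * M t c d)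
        ≈⟨ *-ι-∑ S k (λ t → ∇ a b t ℕ.* ∇ t c d) left ⟩
      k * ι (ℕ-Sum.∑ S (λ t → ∇ a b t ℕ.* ∇ t c d))
        ≡⟨ ≡.cong (λ n → k * ι n) (∇-assoc a b c d) ⟩
      k * ι (ℕ-Sum.∑ S (λ t → ∇ b c t ℕ.* ∇ a t d))
        ≈⟨ *-ι-∑ S k (λ t → ∇ b c t ℕ.* ∇ a t d) right ⟨
      ∑[ t ∈ S ] (M b c t * M a t d) ∎
      where
      k = s d * (r a * (r b * r c))
      left : ∀ t → M a b t * M t c d ≋ k * ι (∇ a b t ℕ.* ∇ t c d)
      left t = begin
        M a b t * M t c d
          ≈⟨ *-cong (M-def a b t) (M-def t c d) ⟩
        s t * (r a * r b) * ι (∇ a b t) * (s d * (r t * r c) * ι (∇ t c d))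
          ≈⟨ solve 8 (λ st rt ra rb rc sd m n →
               (((st ⊕ (ra ⊕ rb)) ⊕ m) ⊕ ((sd ⊕ (rt ⊕ rc)) ⊕ n)) ⊜
               ((st ⊕ rt) ⊕ ((sd ⊕ (ra ⊕ (rb ⊕ rc))) ⊕ (m ⊕ n)))) refl
               (s t) (r t) (r a) (r b) (r c) (s d) (ι (∇ a b t)) (ι (∇ t c d)) ⟩
        s t * r t * (k * (ι (∇ a b t) * ι (∇ t c d)))
          ≈⟨ s*r-cancel t k (∇ a b t) (∇ t c d) ⟩
        k * ι (∇ a b t ℕ.* ∇ t c d) ∎
      right : ∀ t → M b c t * M a t d ≋ k * ι (∇ b c t ℕ.* ∇ a t d)
      right t = begin
        M b c t * M a t d
          ≈⟨ *-cong (M-def b c t) (M-def a t d) ⟩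
        s t * (r b * r c) * ι (∇ b c t) * (s d * (r a * r t) * ι (∇ a t d))
          ≈⟨ solve 8 (λ st rt ra rb rc sd m n →
               (((st ⊕ (rb ⊕ rc)) ⊕ m) ⊕ ((sd ⊕ (ra ⊕ rt)) ⊕ n)) ⊜
               ((st ⊕ rt) ⊕ ((sd ⊕ (ra ⊕ (rb ⊕ rc))) ⊕ (m ⊕ n)))) refl
               (s t) (r t) (r a) (r b) (r c) (s d) (ι (∇ b c t)) (ι (∇ a t d)) ⟩
        s t * r t * (k * (ι (∇ b c t) * ι (∇ a t d)))
          ≈⟨ s*r-cancel t k (∇ b c t) (∇ a t d) ⟩
        k * ι (∇ b c t ℕ.* ∇ a t d) ∎

    s≋r*ι : ∀ a → s a ≋ r a * ι ‖ a ‖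
    s≋r*ι a = begin
      s a                ≈⟨ *-identityˡ (s a) ⟨
      1# * s a           ≈⟨ *-congʳ (s*r a) ⟨
      s a * r a * s a    ≈⟨ solve 2 (λ x y → ((x ⊕ y) ⊕ x) ⊜ (y ⊕ (x ⊕ x))) refl (s a) (r a) ⟩
      r a * (s a * s a)  ≈⟨ *-congˡ (s*s a) ⟩
      r a * ι ‖ a ‖      ∎

    -- Trading `s c` for `r c` times the valency gives the output the same weight as an input. This
    -- is needed where a summation index is the output of both factors.
    M≋ : ∀ a b c → M a b c ≋ r c * (r a * r b) * ι (‖ c ‖ ℕ.* ∇ a b c)
    M≋ a b c = begin
      M a b c
        ≈⟨ M-def a b c ⟩
      s c * (r a * r b) * ι (∇ a b c)
        ≈⟨ *-congʳ (*-congʳ (s≋r*ι c)) ⟩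
      r c * ι ‖ c ‖ * (r a * r b) * ι (∇ a b c)
        ≈⟨ solve 4 (λ x y z n → (((x ⊕ y) ⊕ z) ⊕ n) ⊜ ((x ⊕ z) ⊕ (y ⊕ n))) refl
             (r c) (ι ‖ c ‖) (r a * r b) (ι (∇ a b c)) ⟩
      r c * (r a * r b) * (ι ‖ c ‖ * ι (∇ a b c))
        ≈⟨ *-congˡ (ι-* ‖ c ‖ (∇ a b c)) ⟨
      r c * (r a * r b) * ι (‖ c ‖ ℕ.* ∇ a b c) ∎

    -- Rotating a triangle exchanges the output b with the input t. The valency of b comes from
    -- `M≋`, and the valency of t produced by `∇-rotate` turns `r t` back into `s t`.
    M-rotate : ∀ t d b → M t d b ≋ s t * (r b * r d) * ι (∇ b (d ⁻¹) t)
    M-rotate t d b = begin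
      M t d b
        ≈⟨ M≋ t d b ⟩
      r b * (r t * r d) * ι (‖ b ‖ ℕ.* ∇ t d b)
        ≡⟨ ≡.cong (λ n → r b * (r t * r d) * ι n) (∇-rotate t d b) ⟩
      r b * (r t * r d) * ι (‖ t ‖ ℕ.* ∇ b (d ⁻¹) t)
        ≈⟨ *-congˡ (ι-* ‖ t ‖ (∇ b (d ⁻¹) t)) ⟩
      r b * (r t * r d) * (ι ‖ t ‖ * ι (∇ b (d ⁻¹) t))
        ≈⟨ solve 5 (λ rb rt rd k n → ((rb ⊕ (rt ⊕ rd)) ⊕ (k ⊕ n)) ⊜ (((rt ⊕ k) ⊕ (rb ⊕ rd)) ⊕ n)) refl
             (r b) (r t) (r d) (ι ‖ t ‖) (ι (∇ b (d ⁻¹) t)) ⟩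
      r t * ι ‖ t ‖ * (r b * r d) * ι (∇ b (d ⁻¹) t)
        ≈⟨ *-congʳ (*-congʳ (s≋r*ι t)) ⟨
      s t * (r b * r d) * ι (∇ b (d ⁻¹) t) ∎

    M-frobenius : ∀ a b c d → ∑[ t ∈ S ] (M t d b * M a t c) ≋ ∑[ t ∈ S ] (M a b t * M c d t)
    M-frobenius a b c d = begin
      ∑[ t ∈ S ] (M t d b * M a t c)
        ≈⟨ *-ι-∑ S k (λ t → ‖ c ‖ ℕ.* ∇ a t c ℕ.* ∇ b (d ⁻¹) t) left ⟩
      k * ι (ℕ-Sum.∑ S (λ t → ‖ c ‖ ℕ.* ∇ a t c ℕ.* ∇ b (d ⁻¹) t))
        ≡⟨ ≡.cong (λ n → k * ι n) (∇-frobenius a b c d) ⟨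
      k * ι (ℕ-Sum.∑ S (λ t → ‖ t ‖ ℕ.* ∇ a b t ℕ.* ∇ c d t))
        ≈⟨ *-ι-∑ S k (λ t → ‖ t ‖ ℕ.* ∇ a b t ℕ.* ∇ c d t) right ⟨
      ∑[ t ∈ S ] (M a b t * M c d t) ∎
      where
      k = r a * r b * (r c * r d)
      left : ∀ t → M t d b * M a t c ≋ k * ι (‖ c ‖ ℕ.* ∇ a t c ℕ.* ∇ b (d ⁻¹) t)
      left t = begin
        M t d b * M a t c
          -- Since t is an input of both factors, rotation supplies the `s t` that cancels the other
          -- `r t`; the valency of c moves into the count.
          ≈⟨ *-cong (M-rotate t d b) (M≋ a t c) ⟩
        s t * (r b * r d) * ι (∇ b (d ⁻¹) t) * (r c * (r a * r t) * ι (‖ c ‖ ℕ.* ∇ a t c))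
          ≈⟨ solve 8 (λ st rt ra rb rc rd m n →
               (((st ⊕ (rb ⊕ rd)) ⊕ n) ⊕ ((rc ⊕ (ra ⊕ rt)) ⊕ m)) ⊜
               ((st ⊕ rt) ⊕ (((ra ⊕ rb) ⊕ (rc ⊕ rd)) ⊕ (m ⊕ n)))) refl
               (s t) (r t) (r a) (r b) (r c) (r d) (ι (‖ c ‖ ℕ.* ∇ a t c)) (ι (∇ b (d ⁻¹) t)) ⟩
        s t * r t * (k * (ι (‖ c ‖ ℕ.* ∇ a t c) * ι (∇ b (d ⁻¹) t)))
          ≈⟨ s*r-cancel t k (‖ c ‖ ℕ.* ∇ a t c) (∇ b (d ⁻¹) t) ⟩
        k * ι (‖ c ‖ ℕ.* ∇ a t c ℕ.* ∇ b (d ⁻¹) t) ∎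
      right : ∀ t → M a b t * M c d t ≋ k * ι (‖ t ‖ ℕ.* ∇ a b t ℕ.* ∇ c d t)
      right t = begin
        M a b t * M c d t
          -- Here t is the output of both factors, so one `s t` is traded for `r t`, which yields
          -- the weight `‖ t ‖` of `∇-frobenius`.
          ≈⟨ *-cong (M≋ a b t) (M-def c d t) ⟩
        r t * (r a * r b) * ι (‖ t ‖ ℕ.* ∇ a b t) * (s t * (r c * r d) * ι (∇ c d t))
          ≈⟨ solve 6 (λ st rt x y m n → (((rt ⊕ x) ⊕ m) ⊕ ((st ⊕ y) ⊕ n)) ⊜
               ((st ⊕ rt) ⊕ ((x ⊕ y) ⊕ (m ⊕ n)))) refl
               (s t) (r t) (r a * r b) (r c * r d) (ι (‖ t ‖ ℕ.* ∇ a b t)) (ι (∇ c d t)) ⟩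
        s t * r t * (k * (ι (‖ t ‖ ℕ.* ∇ a b t) * ι (∇ c d t)))
          ≈⟨ s*r-cancel t k (‖ t ‖ ℕ.* ∇ a b t) (∇ c d t) ⟩
        k * ι (‖ t ‖ ℕ.* ∇ a b t ℕ.* ∇ c d t) ∎

    -- `ε` restricts the sum to the identity classes, and the hypothesis on `m` leaves only the one
    -- that contains the loop at x.
    ∑-⊆id : ∀ x (m : Carrier S → K) →
            (∀ i → ⊆id i → χ i (x , x) ≡ 0 → m i ≋ 0#) →
            ∑[ i ∈ S ] (ε i * m i) ≋ m (class (x , x))
    ∑-⊆id x m m≋0 = begin
      ∑[ i ∈ S ] (ε i * m i)  ≈⟨ ∑-single S (λ i → ε i * m i) i₀ others ⟩
      ε i₀ * m i₀             ≈⟨ *-congʳ (ε≋1 i₀ (⊆id-class x)) ⟩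
      1# * m i₀               ≈⟨ *-identityˡ (m i₀) ⟩
      m i₀                    ∎
      where
      i₀ = class (x , x)
      others : ∀ i → i ≢ i₀ → ε i * m i ≋ 0#
      others i i≢i₀ with i ⊆id?
      ... | no i⊈id = trans (*-congʳ (ε≋0 i i⊈id)) (zeroˡ (m i))
      ... | yes i⊆id = trans (*-congˡ (m≋0 i i⊆id
              (ℕ-Sum.𝟙-false (i ∋? (x , x)) (i≢i₀ ∘ class-unique (x , x) i)))) (zeroʳ (ε i))

    M≋0 : ∀ a b c → ∇ a b c ≡ 0 → M a b c ≋ 0#
    M≋0 a b c ∇≡0 = begin
      M a b c                          ≈⟨ M-def a b c ⟩
      s c * (r a * r b) * ι (∇ a b c)  ≡⟨ ≡.cong (λ n → s c * (r a * r b) * ι n) ∇≡0 ⟩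
      s c * (r a * r b) * ι 0          ≈⟨ *-congˡ ι-0 ⟩
      s c * (r a * r b) * 0#           ≈⟨ zeroʳ (s c * (r a * r b)) ⟩
      0#                               ∎

    -- Classes are disjoint, so the chosen pair of c lies in b only if b and c coincide, and then
    -- the weights cancel.
    s*r*ι-χ : ∀ b c → s c * r b * ι (χ b (source c , target c)) ≋ 𝟙 (FinSet._≟_ S b c)
    s*r*ι-χ b c = go (FinSet._≟_ S b c)
      where
      go : Dec (b ≡ c) → s c * r b * ι (χ b (source c , target c)) ≋ 𝟙 (FinSet._≟_ S b c)
      go (yes ≡.refl) = begin
        s c * r c * ι (χ c (source c , target c))
          ≈⟨ *-congʳ (s*r c) ⟩
        1# * ι (χ c (source c , target c))
          ≈⟨ *-identityˡ _ ⟩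
        ι (χ c (source c , target c))
          ≡⟨ ≡.cong ι (ℕ-Sum.𝟙-true (c ∋? (source c , target c)) (∋-source-target c)) ⟩
        ι 1
          ≈⟨ ι-1 ⟩
        1#
          ≈⟨ 𝟙-true (FinSet._≟_ S c c) ≡.refl ⟨
        𝟙 (FinSet._≟_ S c c) ∎
      go (no b≢c) = begin
        s c * r b * ι (χ b (source c , target c))
          ≡⟨ ≡.cong (λ m → s c * r b * ι m) (ℕ-Sum.𝟙-false (b ∋? (source c , target c)) λ b∋ →
               b≢c (≡.trans (class-unique _ b b∋) (≡.sym (class-unique _ c (∋-source-target c))))) ⟩
        s c * r b * ι 0  ≈⟨ *-congˡ ι-0 ⟩
        s c * r b * 0#   ≈⟨ zeroʳ (s c * r b) ⟩
        0#               ≈⟨ 𝟙-false (FinSet._≟_ S b c) b≢c ⟨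
        𝟙 (FinSet._≟_ S b c) ∎

    r-loop : ∀ x → r (class (x , x)) ≋ 1#
    r-loop x = ‖‖≡1⇒r≋1 (class (x , x)) (‖‖-⊆id (⊆id-class x))

    χ-loop : ∀ x k → χ (class (x , x)) (x , x) ℕ.* k ≡ k
    χ-loop x k = ≡.trans
      (≡.cong (ℕ._* k) (ℕ-Sum.𝟙-true (class (x , x) ∋? (x , x)) (class-∋ (x , x)))) (ℕ.*-identityˡ k)

    M-identityˡ : ∀ b c → ∑[ i ∈ S ] (ε i * M i b c) ≋ 𝟙 (FinSet._≟_ S b c)
    M-identityˡ b c = begin
      ∑[ i ∈ S ] (ε i * M i b c)
        ≈⟨ ∑-⊆id x (λ i → M i b c) (λ i i⊆id χ≡0 → M≋0 i b c
             (≡.trans (∇-⊆idˡ b c i⊆id) (≡.cong (ℕ._* n) χ≡0))) ⟩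
      M i₀ b c
        ≈⟨ M-def i₀ b c ⟩
      s c * (r i₀ * r b) * ι (∇ i₀ b c)
        ≡⟨ ≡.cong (λ m → s c * (r i₀ * r b) * ι m) (≡.trans (∇-⊆idˡ b c (⊆id-class x)) (χ-loop x n)) ⟩
      s c * (r i₀ * r b) * ι n
        ≈⟨ *-congʳ (*-congˡ (trans (*-congʳ (r-loop x)) (*-identityˡ (r b)))) ⟩
      s c * r b * ι n
        ≈⟨ s*r*ι-χ b c ⟩
      𝟙 (FinSet._≟_ S b c) ∎
      where
      x  = source c
      i₀ = class (x , x)
      n  = χ b (source c , target c)

    M-identityʳ : ∀ b c → ∑[ i ∈ S ] (ε i * M b i c) ≋ 𝟙 (FinSet._≟_ S b c)
    M-identityʳ b c = begin
      ∑[ i ∈ S ] (ε i * M b i c)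
        ≈⟨ ∑-⊆id y (λ i → M b i c) (λ i i⊆id χ≡0 → M≋0 b i c
             (≡.trans (∇-⊆idʳ b c i⊆id) (≡.cong (ℕ._* n) χ≡0))) ⟩
      M b i₀ c
        ≈⟨ M-def b i₀ c ⟩
      s c * (r b * r i₀) * ι (∇ b i₀ c)
        ≡⟨ ≡.cong (λ m → s c * (r b * r i₀) * ι m) (≡.trans (∇-⊆idʳ b c (⊆id-class y)) (χ-loop y n)) ⟩
      s c * (r b * r i₀) * ι n
        ≈⟨ *-congʳ (*-congˡ (trans (*-congˡ (r-loop y)) (*-identityʳ (r b)))) ⟩
      s c * r b * ι n
        ≈⟨ s*r*ι-χ b c ⟩
      𝟙 (FinSet._≟_ S b c) ∎
      where
      y  = target c
      i₀ = class (y , y)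
      n  = χ b (source c , target c)

-- Entries of composite matrices

-- Entries that agree only up to reduction are related by ∑-*-cong and ≈⁺-refl, and
-- the objects and matrices are kept abstract: letting the type checker compare such
-- entries as factors of a product unfolds the multiplication of reals.
module MatrixEntries where
  open CommutativeSemiring ℝ≥0-commutativeSemiring using (setoid) renaming (refl to ≈⁺-refl)
  open FiniteSum ℝ≥0-commutativeSemiring
  open SetoidReasoning setoid

  row-delta : ∀ X Y (f : Carrier X → Carrier Y) x y → f x ≡ y → Delta Y y (entry (⟪_⟫ {X} {Y} f) x)
  row-delta X Y f x y fx≡y =
    𝟙-delta Y (FinSet._≟_ Y (f x)) y fx≡y (λ _ fx≡y′ → ≡.trans (≡.sym fx≡y′) fx≡y)

  -- A row of the matrix of a function always has a single one, but a column only where the value y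
  -- is attained exactly once.
  column-delta : ∀ X Y (f : Carrier X → Carrier Y) x y → f x ≡ y → (∀ x′ → f x′ ≡ y → x′ ≡ x) →
                 Delta X x (λ x′ → entry (⟪_⟫ {X} {Y} f) x′ y)
  column-delta X Y f x y = 𝟙-delta X (λ x′ → FinSet._≟_ Y (f x′) y) x

  entry-∘-delta : ∀ X Y Z (F : Mat Y Z) (G : Mat X Y) x y z → Delta Y y (entry G x) →
                  entry (F ∘ₘ G) x z ≈⁺ entry F y z
  entry-∘-delta X Y Z F G x y z G-delta = ∑-delta Y y (entry G x) G-delta (λ y → entry F y z)

  entry-delta-∘ : ∀ X Y Z (F : Mat X Y) (G : Mat Y Z) x y z → Delta Y y (λ y′ → entry G y′ z) →
                  entry (G ∘ₘ F) x z ≈⁺ entry F x y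
  entry-delta-∘ X Y Z F G x y z G-delta = begin
    entry (G ∘ₘ F) x z
      ≈⟨ ∑-*-comm Y (entry F x) (λ y′ → entry G y′ z) ⟩
    ∑[ y′ ∈ Y ] (entry G y′ z *⁺ entry F x y′)
      ≈⟨ ∑-delta Y y (λ y′ → entry G y′ z) G-delta (entry F x) ⟩
    entry F x y ∎

  -- The identity strand is summed out by its delta, leaving the sum over the other strand. The
  -- three lemmas that follow vary the side of the strand and the order of composition.
  entry-∘-⊗id : ∀ X Y S Z (F : Mat (Y ⊗₀ S) Z) (G : Mat X Y) x c z →
                entry (F ∘ₘ (G ⊗ idₘ S)) (x , c) z ≈⁺ ∑[ y ∈ Y ] (entry G x y *⁺ entry F (y , c) z)
  entry-∘-⊗id X Y S Z F G x c z =
    ∑-⊗-deltaʳ Y S c (entry (idₘ S) c) (row-delta S S id c c ≡.refl) (entry G x)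
      (λ u → entry F u z) (entry (G ⊗ idₘ S) (x , c))
      (λ y c′ → ≈⁺-refl {entry (G ⊗ idₘ S) (x , c) (y , c′)})

  entry-∘-id⊗ : ∀ X Y S Z (F : Mat (S ⊗₀ Y) Z) (G : Mat X Y) c x z →
                entry (F ∘ₘ (idₘ S ⊗ G)) (c , x) z ≈⁺ ∑[ y ∈ Y ] (entry G x y *⁺ entry F (c , y) z)
  entry-∘-id⊗ X Y S Z F G c x z =
    ∑-⊗-deltaˡ S Y c (entry (idₘ S) c) (row-delta S S id c c ≡.refl) (entry G x)
      (λ u → entry F u z) (entry (idₘ S ⊗ G) (c , x))
      (λ c′ y → ≈⁺-refl {entry (idₘ S ⊗ G) (c , x) (c′ , y)})

  entry-⊗id-∘ : ∀ X Y S Z (F : Mat X (Y ⊗₀ S)) (G : Mat Y Z) x z c →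
                entry ((G ⊗ idₘ S) ∘ₘ F) x (z , c) ≈⁺ ∑[ y ∈ Y ] (entry G y z *⁺ entry F x (y , c))
  entry-⊗id-∘ X Y S Z F G x z c = begin
    entry ((G ⊗ idₘ S) ∘ₘ F) x (z , c)
      ≈⟨ ∑-*-comm (Y ⊗₀ S) (entry F x) (λ u → entry (G ⊗ idₘ S) u (z , c)) ⟩
    ∑[ u ∈ Y ⊗₀ S ] (entry (G ⊗ idₘ S) u (z , c) *⁺ entry F x u)
      ≈⟨ ∑-⊗-deltaʳ Y S c (λ c′ → entry (idₘ S) c′ c) (column-delta S S id c c ≡.refl (λ _ eq → eq))
           (λ y → entry G y z) (entry F x) (λ u → entry (G ⊗ idₘ S) u (z , c))
           (λ y c′ → ≈⁺-refl {entry (G ⊗ idₘ S) (y , c′) (z , c)}) ⟩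
    ∑[ y ∈ Y ] (entry G y z *⁺ entry F x (y , c)) ∎

  entry-id⊗-∘ : ∀ X Y S Z (F : Mat X (S ⊗₀ Y)) (G : Mat Y Z) x c z →
                entry ((idₘ S ⊗ G) ∘ₘ F) x (c , z) ≈⁺ ∑[ y ∈ Y ] (entry G y z *⁺ entry F x (c , y))
  entry-id⊗-∘ X Y S Z F G x c z = begin
    entry ((idₘ S ⊗ G) ∘ₘ F) x (c , z)
      ≈⟨ ∑-*-comm (S ⊗₀ Y) (entry F x) (λ u → entry (idₘ S ⊗ G) u (c , z)) ⟩
    ∑[ u ∈ S ⊗₀ Y ] (entry (idₘ S ⊗ G) u (c , z) *⁺ entry F x u)
      ≈⟨ ∑-⊗-deltaˡ S Y c (λ c′ → entry (idₘ S) c′ c) (column-delta S S id c c ≡.refl (λ _ eq → eq))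
           (λ y → entry G y z) (entry F x) (λ u → entry (idₘ S ⊗ G) u (c , z))
           (λ c′ y → ≈⁺-refl {entry (idₘ S ⊗ G) (c′ , y) (c , z)}) ⟩
    ∑[ y ∈ Y ] (entry G y z *⁺ entry F x (c , y)) ∎

  entry-assocʳ : ∀ S (μ : Mat (S ⊗₀ S) S) a b c d →
                 entry (μ ∘ₘ (idₘ S ⊗ μ) ∘ₘ α S S S) ((a , b) , c) d ≈⁺
                 ∑[ t ∈ S ] (entry μ (b , c) t *⁺ entry μ (a , t) d)
  entry-assocʳ S μ a b c d = begin
    entry (μ ∘ₘ (idₘ S ⊗ μ) ∘ₘ α S S S) ((a , b) , c) d
      ≈⟨ ∑-*-cong (S ⊗₀ S) (entry ((idₘ S ⊗ μ) ∘ₘ α S S S) ((a , b) , c))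
           (entry (idₘ S ⊗ μ) (a , (b , c))) (λ u → entry μ u d) (λ u → entry μ u d)
           (λ u → entry-∘-delta ((S ⊗₀ S) ⊗₀ S) (S ⊗₀ (S ⊗₀ S)) (S ⊗₀ S) (idₘ S ⊗ μ) (α S S S)
                    ((a , b) , c) (a , (b , c)) u
                    (row-delta ((S ⊗₀ S) ⊗₀ S) (S ⊗₀ (S ⊗₀ S)) assocʳ ((a , b) , c) (a , (b , c)) ≡.refl))
           (λ u → ≈⁺-refl {entry μ u d}) ⟩
    entry (μ ∘ₘ (idₘ S ⊗ μ)) (a , (b , c)) d
      ≈⟨ entry-∘-id⊗ (S ⊗₀ S) S S S μ μ a (b , c) d ⟩
    ∑[ t ∈ S ] (entry μ (b , c) t *⁺ entry μ (a , t) d) ∎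

  entry-frobeniusˡ : ∀ S (μ : Mat (S ⊗₀ S) S) a b c d →
                     entry ((μ ⊗ idₘ S) ∘ₘ α⁻¹ S S S ∘ₘ (idₘ S ⊗ μ †)) (a , b) (c , d) ≈⁺
                     ∑[ t ∈ S ] (entry μ (t , d) b *⁺ entry μ (a , t) c)
  entry-frobeniusˡ S μ a b c d = begin
    entry ((μ ⊗ idₘ S) ∘ₘ (α⁻¹ S S S ∘ₘ (idₘ S ⊗ μ †))) (a , b) (c , d)
      ≈⟨ entry-⊗id-∘ (S ⊗₀ S) (S ⊗₀ S) S S (α⁻¹ S S S ∘ₘ (idₘ S ⊗ μ †)) μ (a , b) c d ⟩
    ∑[ u ∈ S ⊗₀ S ] (entry μ u c *⁺ entry (α⁻¹ S S S ∘ₘ (idₘ S ⊗ μ †)) (a , b) (u , d))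
      ≈⟨ ∑-*-comm (S ⊗₀ S) (λ u → entry μ u c) (λ u → entry (α⁻¹ S S S ∘ₘ (idₘ S ⊗ μ †)) (a , b) (u , d)) ⟩
    ∑[ u ∈ S ⊗₀ S ] (entry (α⁻¹ S S S ∘ₘ (idₘ S ⊗ μ †)) (a , b) (u , d) *⁺ entry μ u c)
      -- The entry of the inner composite at ((p, q), d) is that of `idₘ S ⊗ μ †` at (p, (q, d)),
      -- which is supported on p = a.
      ≈⟨ ∑-⊗-deltaˡ S S a (entry (idₘ S) a) (row-delta S S id a a ≡.refl)
           (λ t → entry (μ †) b (t , d)) (λ u → entry μ u c) (λ u → entry (α⁻¹ S S S ∘ₘ (idₘ S ⊗ μ †)) (a , b) (u , d))
           (λ p q → entry-delta-∘ (S ⊗₀ S) (S ⊗₀ (S ⊗₀ S)) ((S ⊗₀ S) ⊗₀ S) (idₘ S ⊗ μ †) (α⁻¹ S S S)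
                      (a , b) (p , (q , d)) ((p , q) , d)
                      (column-delta (S ⊗₀ (S ⊗₀ S)) ((S ⊗₀ S) ⊗₀ S) assocˡ (p , (q , d)) ((p , q) , d)
                        -- Reassociation is injective: apply its inverse.
                        ≡.refl (λ _ → ≡.cong assocʳ))) ⟩
    ∑[ t ∈ S ] (entry (μ †) b (t , d) *⁺ entry μ (a , t) c)
      ≈⟨ ∑-*-cong S (λ t → entry (μ †) b (t , d)) (λ t → entry μ (t , d) b)
           (λ t → entry μ (a , t) c) (λ t → entry μ (a , t) c)
           (λ t → ≈⁺-refl {entry μ (t , d) b}) (λ t → ≈⁺-refl {entry μ (a , t) c}) ⟩
    ∑[ t ∈ S ] (entry μ (t , d) b *⁺ entry μ (a , t) c) ∎

  entry-frobeniusʳ : ∀ S (μ : Mat (S ⊗₀ S) S) a b c d →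
                     entry ((idₘ S ⊗ μ) ∘ₘ α S S S ∘ₘ (μ † ⊗ idₘ S)) (a , b) (c , d) ≈⁺
                     ∑[ t ∈ S ] (entry μ (c , t) a *⁺ entry μ (t , b) d)
  entry-frobeniusʳ S μ a b c d = begin
    entry ((idₘ S ⊗ μ) ∘ₘ (α S S S ∘ₘ (μ † ⊗ idₘ S))) (a , b) (c , d)
      ≈⟨ entry-id⊗-∘ (S ⊗₀ S) (S ⊗₀ S) S S (α S S S ∘ₘ (μ † ⊗ idₘ S)) μ (a , b) c d ⟩
    ∑[ u ∈ S ⊗₀ S ] (entry μ u d *⁺ entry (α S S S ∘ₘ (μ † ⊗ idₘ S)) (a , b) (c , u))
      ≈⟨ ∑-*-comm (S ⊗₀ S) (λ u → entry μ u d) (λ u → entry (α S S S ∘ₘ (μ † ⊗ idₘ S)) (a , b) (c , u)) ⟩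
    ∑[ u ∈ S ⊗₀ S ] (entry (α S S S ∘ₘ (μ † ⊗ idₘ S)) (a , b) (c , u) *⁺ entry μ u d)
      ≈⟨ ∑-⊗-deltaʳ S S b (entry (idₘ S) b) (row-delta S S id b b ≡.refl)
           (λ t → entry (μ †) a (c , t)) (λ u → entry μ u d) (λ u → entry (α S S S ∘ₘ (μ † ⊗ idₘ S)) (a , b) (c , u))
           (λ p q → entry-delta-∘ (S ⊗₀ S) ((S ⊗₀ S) ⊗₀ S) (S ⊗₀ (S ⊗₀ S)) (μ † ⊗ idₘ S) (α S S S)
                      (a , b) ((c , p) , q) (c , (p , q))
                      (column-delta ((S ⊗₀ S) ⊗₀ S) (S ⊗₀ (S ⊗₀ S)) assocʳ ((c , p) , q) (c , (p , q))
                        ≡.refl (λ _ → ≡.cong assocˡ))) ⟩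
    ∑[ t ∈ S ] (entry (μ †) a (c , t) *⁺ entry μ (t , b) d)
      ≈⟨ ∑-*-cong S (λ t → entry (μ †) a (c , t)) (λ t → entry μ (c , t) a)
           (λ t → entry μ (t , b) d) (λ t → entry μ (t , b) d)
           (λ t → ≈⁺-refl {entry μ (c , t) a}) (λ t → ≈⁺-refl {entry μ (t , b) d}) ⟩
    ∑[ t ∈ S ] (entry μ (c , t) a *⁺ entry μ (t , b) d) ∎

  entry-†-∘ : ∀ S (μ : Mat (S ⊗₀ S) S) a b c d → entry (μ † ∘ₘ μ) (a , b) (c , d) ≈⁺
              ∑[ t ∈ S ] (entry μ (a , b) t *⁺ entry μ (c , d) t)
  entry-†-∘ S μ a b c d = ∑-*-cong S (entry μ (a , b)) (entry μ (a , b))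
    (λ t → entry (μ †) t (c , d)) (entry μ (c , d))
    (λ t → ≈⁺-refl {entry μ (a , b) t}) (λ t → ≈⁺-refl {entry μ (c , d) t})

  -- The axioms of a dagger Frobenius structure from identities between entries

  module _ (S : FinSet) (μ : Mat (S ⊗₀ S) S) (η : Mat I₀ S)
    (∑-assoc : ∀ a b c d → ∑[ t ∈ S ] (entry μ (a , b) t *⁺ entry μ (t , c) d) ≈⁺
                           ∑[ t ∈ S ] (entry μ (b , c) t *⁺ entry μ (a , t) d))
    (∑-identityˡ : ∀ b c → ∑[ i ∈ S ] (entry η tt i *⁺ entry μ (i , b) c) ≈⁺ 𝟙 (FinSet._≟_ S b c))
    (∑-identityʳ : ∀ b c → ∑[ i ∈ S ] (entry η tt i *⁺ entry μ (b , i) c) ≈⁺ 𝟙 (FinSet._≟_ S b c))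
    (∑-frobenius : ∀ a b c d → ∑[ t ∈ S ] (entry μ (t , d) b *⁺ entry μ (a , t) c) ≈⁺
                               ∑[ t ∈ S ] (entry μ (a , b) t *⁺ entry μ (c , d) t))
    where

    μ-assoc : μ ∘ₘ (μ ⊗ idₘ S) ≈ μ ∘ₘ (idₘ S ⊗ μ) ∘ₘ α S S S
    entrywise μ-assoc ((a , b) , c) d = begin
      entry (μ ∘ₘ (μ ⊗ idₘ S)) ((a , b) , c) d
        ≈⟨ entry-∘-⊗id (S ⊗₀ S) S S S μ μ (a , b) c d ⟩
      ∑[ t ∈ S ] (entry μ (a , b) t *⁺ entry μ (t , c) d)
        ≈⟨ ∑-assoc a b c d ⟩
      ∑[ t ∈ S ] (entry μ (b , c) t *⁺ entry μ (a , t) d)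
        ≈⟨ entry-assocʳ S μ a b c d ⟨
      entry (μ ∘ₘ (idₘ S ⊗ μ) ∘ₘ α S S S) ((a , b) , c) d ∎

    μ-identityˡ : μ ∘ₘ (η ⊗ idₘ S) ≈ λₘ S
    entrywise μ-identityˡ (tt , b) c = begin
      entry (μ ∘ₘ (η ⊗ idₘ S)) (tt , b) c
        ≈⟨ entry-∘-⊗id I₀ S S S μ η tt b c ⟩
      ∑[ i ∈ S ] (entry η tt i *⁺ entry μ (i , b) c)
        ≈⟨ ∑-identityˡ b c ⟩
      entry (λₘ S) (tt , b) c ∎

    μ-identityʳ : μ ∘ₘ (idₘ S ⊗ η) ≈ ρₘ S
    entrywise μ-identityʳ (b , tt) c = begin
      entry (μ ∘ₘ (idₘ S ⊗ η)) (b , tt) c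
        ≈⟨ entry-∘-id⊗ I₀ S S S μ η b tt c ⟩
      ∑[ i ∈ S ] (entry η tt i *⁺ entry μ (b , i) c)
        ≈⟨ ∑-identityʳ b c ⟩
      entry (ρₘ S) (b , tt) c ∎

    μ-frobeniusˡ : (μ ⊗ idₘ S) ∘ₘ α⁻¹ S S S ∘ₘ (idₘ S ⊗ μ †) ≈ μ † ∘ₘ μ
    entrywise μ-frobeniusˡ (a , b) (c , d) = begin
      entry ((μ ⊗ idₘ S) ∘ₘ α⁻¹ S S S ∘ₘ (idₘ S ⊗ μ †)) (a , b) (c , d)
        ≈⟨ entry-frobeniusˡ S μ a b c d ⟩
      ∑[ t ∈ S ] (entry μ (t , d) b *⁺ entry μ (a , t) c)
        ≈⟨ ∑-frobenius a b c d ⟩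
      ∑[ t ∈ S ] (entry μ (a , b) t *⁺ entry μ (c , d) t)
        ≈⟨ entry-†-∘ S μ a b c d ⟨
      entry (μ † ∘ₘ μ) (a , b) (c , d) ∎

    -- The two Frobenius laws are transposes of each other, so the entrywise identity is used with
    -- (a, b) and (c, d) interchanged.
    μ-frobeniusʳ : μ † ∘ₘ μ ≈ (idₘ S ⊗ μ) ∘ₘ α S S S ∘ₘ (μ † ⊗ idₘ S)
    entrywise μ-frobeniusʳ (a , b) (c , d) = begin
      entry (μ † ∘ₘ μ) (a , b) (c , d)
        ≈⟨ entry-†-∘ S μ a b c d ⟩
      ∑[ t ∈ S ] (entry μ (a , b) t *⁺ entry μ (c , d) t)
        ≈⟨ ∑-*-comm S (entry μ (a , b)) (entry μ (c , d)) ⟩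
      ∑[ t ∈ S ] (entry μ (c , d) t *⁺ entry μ (a , b) t)
        ≈⟨ ∑-frobenius c d a b ⟨
      ∑[ t ∈ S ] (entry μ (t , b) d *⁺ entry μ (c , t) a)
        ≈⟨ ∑-*-comm S (λ t → entry μ (t , b) d) (λ t → entry μ (c , t) a) ⟩
      ∑[ t ∈ S ] (entry μ (c , t) a *⁺ entry μ (t , b) d)
        ≈⟨ entry-frobeniusʳ S μ a b c d ⟨
      entry ((idₘ S ⊗ μ) ∘ₘ α S S S ∘ₘ (μ † ⊗ idₘ S)) (a , b) (c , d) ∎

    entries⇒isDaggerFrobenius : IsDaggerFrobenius S μ η
    entries⇒isDaggerFrobenius = record
      { isMonoid   = record { assoc = μ-assoc ; identityˡ = μ-identityˡ ; identityʳ = μ-identityʳ }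
      ; frobeniusˡ = μ-frobeniusˡ
      ; frobeniusʳ = μ-frobeniusʳ
      }

-- The Frobenius structure of a coherent configuration over the non-negative reals

module _ (C : CoherentConfiguration) where
  open CoherentConfiguration C
  open Counting C using (⊆id)

  normalised⇒isDaggerFrobenius :
    (s r : Carrier S → ℝ≥0) → (∀ a → s a *⁺ s a ≈⁺ fromℕ ‖ a ‖) → (∀ a → s a *⁺ r a ≈⁺ 1⁺) →
    (∀ a → ‖ a ‖ ≡ 1 → r a ≈⁺ 1⁺) →
    (μ : Mat (S ⊗₀ S) S) → (∀ a b c → entry μ (a , b) c ≈⁺ s c *⁺ (r a *⁺ r b) *⁺ fromℕ (∇ a b c)) →
    (η : Mat I₀ S) → (∀ i → ⊆id i → entry η tt i ≈⁺ 1⁺) → (∀ i → ¬ ⊆id i → entry η tt i ≈⁺ 0⁺) →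
    IsDaggerFrobenius S μ η
  normalised⇒isDaggerFrobenius s r s*s s*r ‖‖≡1⇒r≈1 μ μ-def η η≈1 η≈0 =
    entries⇒isDaggerFrobenius S μ η M-assoc M-identityˡ M-identityʳ M-frobenius
    where
    open MatrixEntries using (entries⇒isDaggerFrobenius)
    open Weighted.Normalised ℝ≥0-commutativeSemiring C fromℕ fromℕ-0 fromℕ-1 fromℕ-+ fromℕ-*
      s r s*s s*r ‖‖≡1⇒r≈1 (λ a b → entry μ (a , b)) μ-def (entry η tt) η≈1 η≈0
      using (M-assoc; M-identityˡ; M-identityʳ; M-frobenius)

theorem6p3 : (C : CoherentConfiguration) → let open CoherentConfiguration C in IsDaggerFrobenius S ∇̇ e
theorem6p3 C = normalised⇒isDaggerFrobenius C s r
  (λ a → √[/]-square ‖ a ‖ 1) (λ a → √[n/1]*√[1/n]≈1 ‖ a ‖ {{nz a}}) (λ a → √[1/n]≈1 ‖ a ‖ {{nz a}})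
  ∇̇ ∇̇-def e (λ i → 𝟙-true (i ⊆id?)) (λ i → 𝟙-false (i ⊆id?))
  where
  open CoherentConfiguration C renaming (‖‖-nonZero to nz)
  open FiniteSum ℝ≥0-commutativeSemiring using (𝟙-true; 𝟙-false)
  s r : Carrier S → ℝ≥0
  s a = √[ ‖ a ‖ / 1 ]
  r a = √[ 1 / ‖ a ‖ ] {{nz a}}
  ∇̇-def : ∀ a b c → entry ∇̇ (a , b) c ≈⁺ s c *⁺ (r a *⁺ r b) *⁺ fromℕ (∇ a b c)
  ∇̇-def a b c = *-congʳ {fromℕ (∇ a b c)} {√[ ‖ c ‖ / ‖ a ‖ ℕ.* ‖ b ‖ ] {{ab≢0}}} {s c *⁺ (r a *⁺ r b)}
    (√[c/ab] (‖ a ‖) (‖ b ‖) (‖ c ‖) {{nz a}} {{nz b}} {{ab≢0}})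
    where
    open CommutativeSemiring ℝ≥0-commutativeSemiring using (*-congʳ)
    ab≢0 : ℕ.NonZero (‖ a ‖ ℕ.* ‖ b ‖)
    ab≢0 = ℕ.m*n≢0 (‖ a ‖) (‖ b ‖) {{nz a}} {{nz b}}
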